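{- The problem $\mathrm{BSR}$ can be solved in time $\mathcal{O}^*(\mathtt{P}^{2\mathtt{t}})$.
   Context: $\mathcal{O}^*(f)$ suppresses factors polynomial in the input size. Programs. A (shared memory) program is a tuple $\mathcal{A}=(D,a^0,(P_i)_{i\in[1..\mathtt{t}]})$ with a finite data domain $D$, an initial memory value $a^0\in D$, and threads $P_i$. Let $\mathrm{Op}(D)=\{!a,?a \mid a\in D\}$ ($!a$ writes $a$ to the memory, $?a$ reads $a$ from it). Each thread is a nondeterministic finite automaton $P_i=(\mathrm{Op}(D),Q_i,q_i^0,\delta_i)$ with finite state set $Q_i$, initial state $q_i^0$ and transition relation $\delta_i\subseteq Q_i\times(\mathrm{Op}(D)\cup\{\varepsilon\})\times Q_i$. A configuration is a pair $(\mathit{pc},a)$ with $\mathit{pc}\in Q_1\times\dots\times Q_{\mathtt{t}}$ and $a\in D$; $C$ is the set of all configurations and the initial configuration is $c^0=((q_1^0,\dots,q_{\mathtt{t}}^0),a^0)$. A step lets one thread $P_i$ take a transition from its current state $q$ to $q'$ (the other threads keep their states): a transition $(q,?a,q')$ is possible only if the memory holds $a$, and leaves the memory unchanged; a transition $(q,!b,q')$ is possible for any memory value and sets the memory to $b$; a transition $(q,\varepsilon,q')$ leaves the memory unchanged. A computation is a finite sequence of consecutive steps, written $c\rightarrow^*_{\mathcal{A}}c'$. Stages. A stage is a computation in which only one of the threads writes; the remaining threads are restricted to reading the memory (and $\varepsilon$-transitions). An $\mathtt{s}$-stage computation is a computation that can be split into $\mathtt{s}$ parts, each of which forms a stage. Bounded-Stage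 Reachability ($\mathrm{BSR}$). Input: a program $\mathcal{A}=(D,a^0,(P_i)_{i\in[1..\mathtt{t}]})$, a set $C^f\subseteq C$, and $\mathtt{s}\in\mathbb{N}$. Question: is there an $\mathtt{s}$-stage computation $c^0\rightarrow^*_{\mathcal{A}}c$ for some $c\in C^f$? Parameters: $\mathtt{P}=\max_i|Q_i|$ is the maximum number of states of a thread, $\mathtt{t}$ is the number of threads. -}

module Defs where

open import Data.Bool using (Bool; true; false)
open import Data.Fin using (Fin; zero; suc; toℕ)
open import Data.List as List using (List; []; _∷_; allFin)
open import Data.List.Membership.Propositional using (_∈_)
open import Data.Maybe using (Maybe; just; nothing)
open import Data.Nat using (ℕ; zero; suc; _+_; _*_; _^_; _≤_; _⊔_; NonZero)
open import Data.Nat.Binary using (ℕᵇ; zero; 2[1+_]; 1+[2_]; fromℕ)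
open import Data.Product using (Σ-syntax; ∃-syntax; _×_; _,_)
open import Data.Unit using (⊤)
open import Data.Vec as Vec using (Vec; []; _∷_; lookup; replicate; _[_]≔_)
open import Data.Vec.Relation.Unary.All using (All; []; _∷_)
open import Function using (_⇔_)
open import Relation.Binary.Construct.Closure.ReflexiveTransitive
  using (Star; ε; _◅_; _◅◅_)
open import Relation.Binary.PropositionalEquality using (_≡_)

-- Operations on the data domain Fin d: wr a is !a, rd a is ?a.
data Op (d : ℕ) : Set where
  wr rd : Fin d → Op d

-- The letter ε is nothing.
Label : ℕ → Set
Label d = Maybe (Op d)

-- The state set is Fin states.
record Thread (d : ℕ) : Set where
  field
    states  : ℕ
    initial : Fin states
    δ       : List (Fin states × Label d × Fin states)

  State : Set
  State = Fin states

open Thread public using (State)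

record Program : Set where
  field
    d           : ℕ
    a⁰          : Fin d
    t           : ℕ
    {{t-nonZero}} : NonZero t
    threads     : Vec (Thread d) t

PC : ∀ {d t} → Vec (Thread d) t → Set
PC = All State

initialPC : ∀ {d t} (Ps : Vec (Thread d) t) → PC Ps
initialPC []       = []
initialPC (P ∷ Ps) = Thread.initial P ∷ initialPC Ps

data MemStep {d : ℕ} : Fin d → Label d → Fin d → Set where
  read  : ∀ {a}   → MemStep a (just (rd a)) a
  write : ∀ {a b} → MemStep a (just (wr b)) b
  skip  : ∀ {a}   → MemStep a nothing a

-- ThreadStep o i pc pc′: thread i takes a transition labelled o and all
-- other threads keep their states.
data ThreadStep {d : ℕ} (o : Label d) :
  ∀ {t} {Ps : Vec (Thread d) t} → Fin t → PC Ps → PC Ps → Set where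
  here  : ∀ {t P} {Ps : Vec (Thread d) t} {q q′ : State P} {pc : PC Ps} →
          (q , o , q′) ∈ Thread.δ P →
          ThreadStep o {Ps = P ∷ Ps} zero (q ∷ pc) (q′ ∷ pc)
  there : ∀ {t P} {Ps : Vec (Thread d) t} {i} {q : State P} {pc pc′ : PC Ps} →
          ThreadStep o i pc pc′ →
          ThreadStep o {Ps = P ∷ Ps} (suc i) (q ∷ pc) (q ∷ pc′)

module _ (A : Program) where
  open Program A

  Config : Set
  Config = PC threads × Fin d

  c⁰ : Config
  c⁰ = initialPC threads , a⁰

  record Step (c c′ : Config) : Set where
    constructor step
    field
      thread     : Fin t
      label      : Label d
      threadStep : let (pc , _) = c ; (pc′ , _) = c′ in
                   ThreadStep label thread pc pc′
      memStep    : let (_ , a) = c ; (_ , a′) = c′ in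
                   MemStep a label a′

  Computation : Config → Config → Set
  Computation = Star Step

  WritesOnlyBy : Fin t → ∀ {c c′} → Step c c′ → Set
  WritesOnlyBy i (step j (just (wr _)) _ _) = j ≡ i
  WritesOnlyBy i (step j (just (rd _)) _ _) = ⊤
  WritesOnlyBy i (step j nothing      _ _) = ⊤

  OnlyWriter : Fin t → ∀ {c c′} → Computation c c′ → Set
  OnlyWriter i ε       = ⊤
  OnlyWriter i (x ◅ γ) = WritesOnlyBy i x × OnlyWriter i γ

  -- A stage has at most one writing thread; it may be empty or write nothing.
  IsStage : ∀ {c c′} → Computation c c′ → Set
  IsStage γ = ∃[ i ] OnlyWriter i γ

  data IsStaged : ℕ → ∀ {c c′} → Computation c c′ → Set where
    []  : ∀ {c} → IsStaged 0 (ε {x = c})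
    _∷_ : ∀ {s c c′ c″} {γ : Computation c c′} {γ′ : Computation c′ c″} →
          IsStage γ → IsStaged s γ′ → IsStaged (suc s) (γ ◅◅ γ′)

record Instance : Set where
  field
    program : Program
    Cᶠ      : List (Config program)
    s       : ℕ

Reachable : Instance → Set
Reachable I = ∃[ c ] (c ∈ Cᶠ × (Σ[ γ ∈ Computation program (c⁰ program) c ]
                                  IsStaged program s γ))
  where open Instance I

maxStates : Program → ℕ
maxStates A = Vec.foldr′ _⊔_ 0 (Vec.map Thread.states (Program.threads A))

-- Machine model: while-programs over binary trees (the language WHILE of
-- N. D. Jones, Computability and Complexity from a Programming
-- Perspective, with a conditional).  Trees are immutable and assignment
-- copies a pointer, so a unit of cost is a constant number of operations
-- of a random access machine.  The only test is that for nil.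

infixr 6 _∙_

data Tree : Set where
  nil : Tree
  _∙_ : Tree → Tree → Tree

size : Tree → ℕ
size nil     = 1
size (l ∙ r) = suc (size l + size r)

isTrue : Tree → Bool
isTrue nil     = false
isTrue (_ ∙ _) = true

hdᵗ tlᵗ : Tree → Tree
hdᵗ nil     = nil
hdᵗ (l ∙ _) = l
tlᵗ nil     = nil
tlᵗ (_ ∙ r) = r

data Exp (n : ℕ) : Set where
  var   : Fin n → Exp n
  nil   : Exp n
  cons  : Exp n → Exp n → Exp n
  hd tl : Exp n → Exp n

infix  4 _≔_
infixr 3 _⨾_

data Cmd (n : ℕ) : Set where
  _≔_           : Fin n → Exp n → Cmd n
  _⨾_           : Cmd n → Cmd n → Cmd n
  if_then_else_ : Exp n → Cmd n → Cmd n → Cmd n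
  while_loop_   : Exp n → Cmd n → Cmd n

Store : ℕ → Set
Store n = Vec Tree n

eval : ∀ {n} → Exp n → Store n → Tree
eval (var x)    σ = lookup σ x
eval nil        σ = nil
eval (cons e f) σ = eval e σ ∙ eval f σ
eval (hd e)     σ = hdᵗ (eval e σ)
eval (tl e)     σ = tlᵗ (eval e σ)

cost : ∀ {n} → Exp n → ℕ
cost (var x)    = 1
cost nil        = 1
cost (cons e f) = suc (cost e + cost f)
cost (hd e)     = suc (cost e)
cost (tl e)     = suc (cost e)

-- C , σ ⇓[ m ] τ: started in store σ, the command C terminates in store τ
-- after time m.
infix 2 _,_⇓[_]_

data _,_⇓[_]_ {n : ℕ} : Cmd n → Store n → ℕ → Store n → Set where
  assign : ∀ {x e σ} →
           (x ≔ e) , σ ⇓[ suc (cost e) ] (σ [ x ]≔ eval e σ)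
  seq    : ∀ {C D σ τ υ m k} →
           C , σ ⇓[ m ] τ → D , τ ⇓[ k ] υ →
           (C ⨾ D) , σ ⇓[ suc (m + k) ] υ
  if-t   : ∀ {e C D σ τ m} → isTrue (eval e σ) ≡ true →
           C , σ ⇓[ m ] τ →
           (if e then C else D) , σ ⇓[ suc (cost e + m) ] τ
  if-f   : ∀ {e C D σ τ m} → isTrue (eval e σ) ≡ false →
           D , σ ⇓[ m ] τ →
           (if e then C else D) , σ ⇓[ suc (cost e + m) ] τ
  loop-t : ∀ {e C σ τ υ m k} → isTrue (eval e σ) ≡ true →
           C , σ ⇓[ m ] τ → (while e loop C) , τ ⇓[ k ] υ →
           (while e loop C) , σ ⇓[ suc (cost e + m + k) ] υ
  loop-f : ∀ {e C σ} → isTrue (eval e σ) ≡ false →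
           (while e loop C) , σ ⇓[ suc (cost e) ] σ

-- Input and output are passed in variable zero; all other variables are
-- initially nil.
record WhileProgram : Set where
  field
    locals : ℕ
    body   : Cmd (suc locals)

Runs : WhileProgram → Tree → ℕ → Tree → Set
Runs p x m y = ∃[ τ ] (body , (x ∷ replicate locals nil) ⇓[ m ] (y ∷ τ))
  where open WhileProgram p

record DecisionProblem : Set₁ where
  field
    Input  : Set
    encode : Input → Tree
    Yes    : Input → Set

  inputSize : Input → ℕ
  inputSize x = size (encode x)

-- As inputSize is positive, every polynomial in it is bounded by one of
-- the form c * n ^ k.
O* : (Π : DecisionProblem) (f T : DecisionProblem.Input Π → ℕ) → Set
O* Π f T = ∃[ c ] ∃[ k ] (∀ x → T x ≤ c * inputSize x ^ k * f x)
  where open DecisionProblem Π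

SolvesInTime : (Π : DecisionProblem) → WhileProgram →
               (DecisionProblem.Input Π → ℕ) → Set
SolvesInTime Π p T =
  ∀ x → ∃[ m ] ∃[ y ] (Runs p (encode x) m y × m ≤ T x ×
                       (isTrue y ≡ true ⇔ Yes x))
  where open DecisionProblem Π

SolvableInTimeO* : (Π : DecisionProblem) → (DecisionProblem.Input Π → ℕ) → Set
SolvableInTimeO* Π f = ∃[ p ] ∃[ T ] (O* Π f T × SolvesInTime Π p T)

-- The encoding of instances: numbers are written in (bijective) binary,
-- finite sets are lists of their elements.

encodeList : ∀ {A : Set} → (A → Tree) → List A → Tree
encodeList f []       = nil
encodeList f (x ∷ xs) = f x ∙ encodeList f xs

encodeℕᵇ : ℕᵇ → Tree
encodeℕᵇ zero     = nil
encodeℕᵇ 2[1+ n ] = nil ∙ encodeℕᵇ n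
encodeℕᵇ 1+[2 n ] = (nil ∙ nil) ∙ encodeℕᵇ n

encodeℕ : ℕ → Tree
encodeℕ n = encodeℕᵇ (fromℕ n)

encodeFin : ∀ {n} → Fin n → Tree
encodeFin i = encodeℕ (toℕ i)

encodeSet : ℕ → Tree
encodeSet n = encodeList (encodeFin {n}) (allFin n)

encodeLabel : ∀ {d} → Label d → Tree
encodeLabel nothing      = nil
encodeLabel (just (rd a)) = nil ∙ encodeFin a
encodeLabel (just (wr a)) = (nil ∙ nil) ∙ encodeFin a

encodeThread : ∀ {d} → Thread d → Tree
encodeThread P =
  encodeSet states ∙ encodeFin initial ∙
  encodeList (λ (q , o , q′) → encodeFin q ∙ encodeLabel o ∙ encodeFin q′) δ
  where open Thread P

encodeProgram : Program → Tree
encodeProgram A =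
  encodeSet d ∙ encodeFin a⁰ ∙ encodeList encodeThread (Vec.toList threads)
  where open Program A

encodePC : ∀ {d t} {Ps : Vec (Thread d) t} → PC Ps → Tree
encodePC []       = nil
encodePC (q ∷ pc) = encodeFin q ∙ encodePC pc

encodeConfig : ∀ {A} → Config A → Tree
encodeConfig (pc , a) = encodePC pc ∙ encodeFin a

encodeInstance : Instance → Tree
encodeInstance I =
  encodeProgram program ∙ encodeList (encodeConfig {program}) Cᶠ ∙ encodeℕ s
  where open Instance I

BSR : DecisionProblem
BSR = record
  { Input  = Instance
  ; encode = encodeInstance
  ; Yes    = Reachable
  }

{-# OPTIONS --safe #-}
module Submission where

-- The nodes of the search are the triples of a writer, a memory value and
-- the states of the threads; there are M ≤ t · d · P ^ t of them.  A search
-- in order of the number of stages keeps a table that assigns a mark to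
-- each node: done (explored), current (reached in the current stage), next
-- (a stage can start here) or unseen.  A round explores one current node by
-- a scan of the table; if there is none, it first begins a new stage by
-- making the next nodes current.  Since a round that does not finish the
-- search explores a node, M rounds suffice even if s is exponential, and
-- the time is M ^ 2 up to a polynomial.
--
-- The algorithm is written in a functional language whose only loops are
-- folds bounded by one of two clocks: a short one as long as the size of
-- the input and a long one of length M, namely the list of all nodes.
-- A bound on the running time can then be read off the syntax of a term.

open import Defs
open import Data.Bool using (true; false)
open import Data.Empty using (⊥; ⊥-elim)
open import Data.Fin using (Fin; zero; suc; toℕ)
import Data.Fin.Properties as Fin
open import Data.List as List using (List; []; _∷_; length; _++_; cartesianProduct; allFin)
open import Data.List.Membership.Propositional using (_∈_; find; lose)
open import Data.List.Membership.Propositional.Properties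
  using (∈-cartesianProduct⁺; ∈-allFin; ∈-map⁺)
open import Data.List.Properties using (length-++; length-map; length-tabulate)
open import Data.List.Relation.Unary.Any using (Any; here; there)
open import Data.Maybe using (just; nothing)
open import Data.Nat
  using (ℕ; zero; suc; _+_; _*_; _^_; _≤_; _<_; _⊔_; z≤n; s≤s; NonZero; >-nonZero)
open import Data.Nat.Binary using (ℕᵇ; zero; 2[1+_]; 1+[2_]; fromℕ; pred)
import Data.Nat.Binary.Properties as Binary
open import Data.Nat.Properties
open import Data.Nat.Tactic.RingSolver using (solve-∀)
open import Data.Product using (Σ-syntax; ∃-syntax; _×_; _,_; proj₁; proj₂)
open import Data.Sum using (_⊎_; inj₁; inj₂)
open import Data.Unit using (⊤; tt)
open import Data.Vec as Vec using (Vec; []; _∷_; lookup; _[_]≔_)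
open import Data.Vec.Relation.Binary.Pointwise.Inductive as Pointwise
  using (Pointwise; []; _∷_)
open import Data.Vec.Relation.Unary.All using (All; []; _∷_)
open import Function using (_∘_; _⇔_; mk⇔; Equivalence)
open import Relation.Binary.Construct.Closure.ReflexiveTransitive using (ε; _◅_)
open import Relation.Binary.PropositionalEquality
  using (_≡_; _≢_; refl; sym; trans; cong; cong₂; subst)
open import Relation.Nullary using (¬_)

-- The exponent `2 * t` allows just two factors `M`, while any polynomial in the input size is free.
-- Hence the two clocks: the nesting of long folds has to be counted exactly, and it is two deep,
-- the fold over the rounds and a scan of the table within a round; comparisons of nodes, steps and
-- the stage counter run on the short clock. As `M` may be exponential, the long clock cannot be
-- read off the input. It is built by crossing the sets of states, values and writers, and each
-- crossing is clocked by the list obtained so far.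
--
-- The writer belongs to a node because it decides which writes are allowed, and it may change only
-- between stages. The marks current and next keep the nodes of the present stage apart from those
-- that cost another one: if a stage is always exhausted before the next begins, no node is first
-- explored in a later stage than necessary, so a done node need not be explored again. Once neither
-- a current nor a next node is left, the done nodes are closed under moves and changes of writer.

-- A functional language with clocked folds

len : Tree → ℕ
len nil     = 0
len (_ ∙ t) = suc (len t)

data Clock : Set where
  short long : Clock

-- The body of `call` sees only its arguments, so a subroutine can be used under any binders without
-- weakening.
data Term (n : ℕ) : Set where
  ref       : Fin n → Term n
  leaf      : Term n
  pair      : Term n → Term n → Term n
  fst snd   : Term n → Term n
  cond      : Term n → Term n → Term n → Term n
  bind      : Term n → Term (suc n) → Term n
  call      : ∀ {m} → Term m → Vec (Term n) m → Term n
  fold      : Clock → Term n → Term n → Term (2 + n) → Term n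
  longClock : Term n

condᵗ : Tree → Tree → Tree → Tree
condᵗ nil     u v = v
condᵗ (_ ∙ _) u v = u

-- The fold stops early if the list is longer than the clock.
foldᵗ : Tree → Tree → (Tree → Tree → Tree) → Tree → Tree
foldᵗ nil     l       f a = a
foldᵗ (_ ∙ c) nil     f a = a
foldᵗ (_ ∙ c) (h ∙ l) f a = foldᵗ c l f (f h a)

module Semantics (K : Clock → Tree) where

  mutual
    ⟦_⟧ : ∀ {n} → Term n → Vec Tree n → Tree
    ⟦ ref i ⟧        ρ = lookup ρ i
    ⟦ leaf ⟧         ρ = nil
    ⟦ pair a b ⟧     ρ = ⟦ a ⟧ ρ ∙ ⟦ b ⟧ ρ
    ⟦ fst a ⟧        ρ = hdᵗ (⟦ a ⟧ ρ)
    ⟦ snd a ⟧        ρ = tlᵗ (⟦ a ⟧ ρ)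
    ⟦ cond a b c ⟧   ρ = condᵗ (⟦ a ⟧ ρ) (⟦ b ⟧ ρ) (⟦ c ⟧ ρ)
    ⟦ bind a b ⟧     ρ = ⟦ b ⟧ (⟦ a ⟧ ρ ∷ ρ)
    ⟦ call f as ⟧    ρ = ⟦ f ⟧ (⟦ as ⟧* ρ)
    ⟦ fold κ l z b ⟧ ρ = foldᵗ (K κ) (⟦ l ⟧ ρ) (λ h a → ⟦ b ⟧ (h ∷ a ∷ ρ)) (⟦ z ⟧ ρ)
    ⟦ longClock ⟧    ρ = K long

    ⟦_⟧* : ∀ {n m} → Vec (Term n) m → Vec Tree n → Vec Tree m
    ⟦ [] ⟧*     ρ = []
    ⟦ a ∷ as ⟧* ρ = ⟦ a ⟧ ρ ∷ ⟦ as ⟧* ρ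

infixr 5 _⊕_
infixr 6 _⊛_

data Cost : Set where
  con : ℕ → Cost
  _⊕_ : Cost → Cost → Cost
  _⊛_ : Clock → Cost → Cost

evalCost : (Clock → ℕ) → Cost → ℕ
evalCost L (con c) = c
evalCost L (p ⊕ q) = evalCost L p + evalCost L q
evalCost L (κ ⊛ p) = L κ * evalCost L p

-- Compilation to while-programs

-- Variable zero holds a stack of trees, the other two hold the clocks.
stack : Exp 3
stack = var zero

clockVar : Clock → Fin 3
clockVar short = suc zero
clockVar long  = suc (suc zero)

drop : ℕ → Exp 3
drop zero    = stack
drop (suc k) = tl (drop k)

peek : ℕ → Exp 3
peek k = hd (drop k)

set : Exp 3 → Cmd 3
set e = zero ≔ e

positions : ∀ m → Vec ℕ m
positions zero    = []
positions (suc m) = 0 ∷ Vec.map suc (positions m)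

-- While a fold runs, the stack holds the clock, the accumulator and the rest of the list, above the
-- old stack. `nextElement` puts the head of the list on top; after the body the new accumulator
-- lies above that head, so `endElement` finds the clock at 2 and the list at 4.
nextElement endElement : Cmd 3
nextElement = set (cons (hd (peek 2)) stack)
endElement  = set (cons (tl (peek 2)) (cons (peek 0) (cons (tl (peek 4)) (drop 5))))

-- The loop tests only the clock; an exhausted list therefore ends it by erasing the clock.
stopClock : Cmd 3
stopClock = set (cons nil (drop 1))

foldBody : Cmd 3 → Cmd 3
foldBody C = if peek 2 then (nextElement ⨾ C ⨾ endElement) else stopClock

foldLoop : Cmd 3 → Cmd 3
foldLoop C = while peek 0 loop foldBody C

-- compile a p pushes the value of a on the stack, where p gives the
-- positions of the values of the variables on the stack.
mutual
  compile : ∀ {n} → Term n → Vec ℕ n → Cmd 3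
  compile (ref i)        p = set (cons (peek (lookup p i)) stack)
  compile leaf           p = set (cons nil stack)
  compile (pair a b)     p = compile a p ⨾ compile b (Vec.map suc p) ⨾
                             set (cons (cons (peek 1) (peek 0)) (drop 2))
  compile (fst a)        p = compile a p ⨾ set (cons (hd (peek 0)) (drop 1))
  compile (snd a)        p = compile a p ⨾ set (cons (tl (peek 0)) (drop 1))
  compile (cond a b c)   p = compile a p ⨾ (if peek 0 then (set (drop 1) ⨾ compile b p)
                                                      else (set (drop 1) ⨾ compile c p))
  compile (bind a b)     p = compile a p ⨾ compile b (0 ∷ Vec.map suc p) ⨾
                             set (cons (peek 0) (drop 2))
  compile (call {m} f as) p = compile* as p ⨾ compile f (positions m) ⨾
                             set (cons (peek 0) (drop (suc m)))
  compile (fold κ l z b) p = compile l p ⨾ compile z (Vec.map suc p) ⨾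
                             set (cons (var (clockVar κ)) stack) ⨾
                             -- Inside the body the element is at 0, the clock at 1, the accumulator
                             -- at 2 and the list at 3, which moves all other variables by 4.
                             foldLoop (compile b (0 ∷ 2 ∷ Vec.map (4 +_) p)) ⨾
                             set (cons (peek 1) (drop 3))
  compile longClock      p = set (cons (var (clockVar long)) stack)

  compile* : ∀ {n m} → Vec (Term n) m → Vec ℕ n → Cmd 3
  compile* []             p = set stack
  -- Arguments are pushed from the last to the first, so that the first ends on top, as `positions`
  -- expects.
  compile* {m = suc m} (a ∷ as) p = compile* as p ⨾ compile a (Vec.map (m +_) p)

setCost : Exp 3 → Cost
setCost e = con (suc (cost e))

infixr 4 _⨾ᶜ_
_⨾ᶜ_ : Cost → Cost → Cost
c ⨾ᶜ d = con 1 ⊕ c ⊕ d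

foldBodyCost : Cost → Cost
foldBodyCost c = con (suc (cost (peek 2))) ⊕
  (setCost (cons (hd (peek 2)) stack) ⨾ᶜ c ⨾ᶜ
   setCost (cons (tl (peek 2)) (cons (peek 0) (cons (tl (peek 4)) (drop 5))))) ⊕
  setCost (cons nil (drop 1))

mutual
  -- The costs of both branches of a conditional are added, which overestimates but keeps the cost a
  -- polynomial free of maxima.
  time : ∀ {n} → Term n → Vec ℕ n → Cost
  time (ref i)        p = setCost (cons (peek (lookup p i)) stack)
  time leaf           p = setCost (cons nil stack)
  time (pair a b)     p = time a p ⨾ᶜ time b (Vec.map suc p) ⨾ᶜ
                          setCost (cons (cons (peek 1) (peek 0)) (drop 2))
  time (fst a)        p = time a p ⨾ᶜ setCost (cons (hd (peek 0)) (drop 1))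
  time (snd a)        p = time a p ⨾ᶜ setCost (cons (tl (peek 0)) (drop 1))
  time (cond a b c)   p = time a p ⨾ᶜ (con (suc (cost (peek 0))) ⊕
                          (setCost (drop 1) ⨾ᶜ time b p) ⊕ (setCost (drop 1) ⨾ᶜ time c p))
  time (bind a b)     p = time a p ⨾ᶜ time b (0 ∷ Vec.map suc p) ⨾ᶜ
                          setCost (cons (peek 0) (drop 2))
  time (call {m} f as) p = time* as p ⨾ᶜ time f (positions m) ⨾ᶜ
                          setCost (cons (peek 0) (drop (suc m)))
  time (fold κ l z b) p = time l p ⨾ᶜ time z (Vec.map suc p) ⨾ᶜ
                          setCost (cons (var (clockVar κ)) stack) ⨾ᶜ
                          ((κ ⊛ (con (suc (cost (peek 0))) ⊕
                                 foldBodyCost (time b (0 ∷ 2 ∷ Vec.map (4 +_) p)))) ⊕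
                           con (suc (cost (peek 0)))) ⨾ᶜ
                          setCost (cons (peek 1) (drop 3))
  time longClock      p = setCost (cons (var (clockVar long)) stack)

  time* : ∀ {n m} → Vec (Term n) m → Vec ℕ n → Cost
  time* []             p = setCost stack
  time* {m = suc m} (a ∷ as) p = time* as p ⨾ᶜ time a (Vec.map (m +_) p)

-- Correctness and running time of compiled terms

infix 2 _,_⇓≤[_]_

_,_⇓≤[_]_ : ∀ {n} → Cmd n → Store n → ℕ → Store n → Set
C , σ ⇓≤[ b ] τ = ∃[ m ] ((C , σ ⇓[ m ] τ) × m ≤ b)

module _ {n : ℕ} where

  assign≤ : ∀ {x} {e : Exp n} {σ} → (x ≔ e) , σ ⇓≤[ suc (cost e) ] (σ [ x ]≔ eval e σ)
  assign≤ = _ , assign , ≤-refl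

  seq≤ : ∀ {C D : Cmd n} {σ τ υ b b′} → (C , σ ⇓≤[ b ] τ) → (D , τ ⇓≤[ b′ ] υ) →
         (C ⨾ D) , σ ⇓≤[ suc (b + b′) ] υ
  seq≤ (_ , r , p) (_ , s , q) = _ , seq r s , s≤s (+-mono-≤ p q)

  if-t≤ : ∀ {e : Exp n} {C D σ τ b b′} → isTrue (eval e σ) ≡ true → (C , σ ⇓≤[ b ] τ) →
          (if e then C else D) , σ ⇓≤[ suc (cost e) + (b + b′) ] τ
  if-t≤ {e = e} t (_ , r , p) =
    _ , if-t t r , s≤s (+-monoʳ-≤ (cost e) (≤-trans p (m≤m+n _ _)))

  if-f≤ : ∀ {e : Exp n} {C D σ τ b b′} → isTrue (eval e σ) ≡ false → (D , σ ⇓≤[ b′ ] τ) →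
          (if e then C else D) , σ ⇓≤[ suc (cost e) + (b + b′) ] τ
  if-f≤ {e = e} t (_ , r , p) =
    _ , if-f t r , s≤s (+-monoʳ-≤ (cost e) (≤-trans p (m≤n+m _ _)))

  loop-t≤ : ∀ {e : Exp n} {C σ τ υ b b′} → isTrue (eval e σ) ≡ true → (C , σ ⇓≤[ b ] τ) →
            ((while e loop C) , τ ⇓≤[ b′ ] υ) →
            (while e loop C) , σ ⇓≤[ suc (cost e) + b + b′ ] υ
  loop-t≤ {e = e} t (_ , r , p) (_ , s , q) =
    _ , loop-t t r s , s≤s (+-mono-≤ (+-monoʳ-≤ (cost e) p) q)

  loop-f≤ : ∀ {e : Exp n} {C σ} → isTrue (eval e σ) ≡ false →
            (while e loop C) , σ ⇓≤[ suc (cost e) ] σ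
  loop-f≤ t = _ , loop-f t , ≤-refl

  weaken≤ : ∀ {C : Cmd n} {σ τ b b′} → b ≤ b′ → (C , σ ⇓≤[ b ] τ) → C , σ ⇓≤[ b′ ] τ
  weaken≤ b≤b′ (m , r , p) = m , r , ≤-trans p b≤b′

dropᵗ : ℕ → Tree → Tree
dropᵗ zero    s = s
dropᵗ (suc k) s = tlᵗ (dropᵗ k s)

dropᵗ-suc : ∀ k v s → dropᵗ (suc k) (v ∙ s) ≡ dropᵗ k s
dropᵗ-suc zero    v s = refl
dropᵗ-suc (suc k) v s = cong tlᵗ (dropᵗ-suc k v s)

eval-drop : ∀ k s {cs : Vec Tree 2} → eval (drop k) (s ∷ cs) ≡ dropᵗ k s
eval-drop zero    s = refl
eval-drop (suc k) s = cong tlᵗ (eval-drop k s)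

module Soundness (K : Clock → Tree) where
  open Semantics K

  L : Clock → ℕ
  L κ = len (K κ)

  with-stack : Tree → Store 3
  with-stack s = s ∷ K short ∷ K long ∷ []

  Pushes : Cmd 3 → Cost → Tree → Tree → Set
  Pushes C c s v = C , with-stack s ⇓≤[ evalCost L c ] with-stack (v ∙ s)

  Located : Tree → ℕ → Tree → Set
  Located s k v = hdᵗ (dropᵗ k s) ≡ v

  Env : ∀ {n} → Tree → Vec ℕ n → Vec Tree n → Set
  Env s = Pointwise (Located s)

  Env-push : ∀ {n s v} {p : Vec ℕ n} {ρ} → Env s p ρ → Env (v ∙ s) (Vec.map suc p) ρ
  Env-push []                         = []
  Env-push {s = s} {v} (_∷_ {x = k} e es) =
    trans (cong hdᵗ (dropᵗ-suc k v s)) e ∷ Env-push es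

  pushAll : ∀ {m} → Vec Tree m → Tree → Tree
  pushAll []       s = s
  pushAll (v ∷ vs) s = v ∙ pushAll vs s

  dropᵗ-pushAll : ∀ {m} (vs : Vec Tree m) k s → dropᵗ (m + k) (pushAll vs s) ≡ dropᵗ k s
  dropᵗ-pushAll []       k s = refl
  dropᵗ-pushAll {suc m} (v ∷ vs) k s =
    trans (dropᵗ-suc (m + k) v (pushAll vs s)) (dropᵗ-pushAll vs k s)

  Env-pushAll : ∀ {n m s} (vs : Vec Tree m) {p : Vec ℕ n} {ρ} →
                Env s p ρ → Env (pushAll vs s) (Vec.map (m +_) p) ρ
  Env-pushAll vs []                 = []
  Env-pushAll {s = s} vs (_∷_ {x = k} e es) =
    trans (cong hdᵗ (dropᵗ-pushAll vs k s)) e ∷ Env-pushAll vs es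

  Env-positions : ∀ {m} (vs : Vec Tree m) s → Env (pushAll vs s) (positions m) vs
  Env-positions []       s = []
  Env-positions (v ∷ vs) s = refl ∷ Env-push (Env-positions vs s)

  Env-lookup : ∀ {n s} {p : Vec ℕ n} {ρ} → Env s p ρ → ∀ i →
               hdᵗ (dropᵗ (lookup p i) s) ≡ lookup ρ i
  Env-lookup es i = Pointwise.lookup es i

  set≤ : ∀ {s s′} e → eval e (with-stack s) ≡ s′ →
         set e , with-stack s ⇓≤[ evalCost L (setCost e) ] with-stack s′
  set≤ e refl = assign≤

  module _ (C : Cmd 3) (c : Cost) (f : Tree → Tree → Tree) (s : Tree)
           (pushes : ∀ h k a l → Pushes C c (h ∙ k ∙ a ∙ l ∙ s) (f h a)) where

    -- One round is charged per tick and one test at the end. The leftover list `l′` depends on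
    -- which of clock and list runs out first; the compiled fold discards it.
    foldLoop≤ : ∀ k l a → ∃[ l′ ] (foldLoop C , with-stack (k ∙ a ∙ l ∙ s)
                 ⇓≤[ len k * (suc (cost (peek 0)) + evalCost L (foldBodyCost c))
                     + suc (cost (peek 0)) ]
                 with-stack (nil ∙ foldᵗ k l f a ∙ l′ ∙ s))
    foldLoop≤ nil     l a = l , loop-f≤ refl
    -- Erasing the clock takes at most one round, which the tick `x` pays for.
    foldLoop≤ (x ∙ k) nil a = nil ,
      weaken≤ (+-monoˡ-≤ (suc (cost (peek 0))) (m≤m+n round (len k * round)))
        (loop-t≤ refl (if-f≤ {b = evalCost L stepCost} refl assign≤) (loop-f≤ refl))
      where
      round = suc (cost (peek 0)) + evalCost L (foldBodyCost c)
      stepCost = setCost (cons (hd (peek 2)) stack) ⨾ᶜ c ⨾ᶜ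
                       setCost (cons (tl (peek 2)) (cons (peek 0) (cons (tl (peek 4)) (drop 5))))
    foldLoop≤ (x ∙ k) (h ∙ l) a with foldLoop≤ k l (f h a)
    ... | l′ , r = l′ ,
      weaken≤ (≤-reflexive (sym (+-assoc (suc (cost (peek 0)) + evalCost L (foldBodyCost c)) (len k * _) _)))
        (loop-t≤ refl
          (if-t≤ {b′ = evalCost L (setCost (cons nil (drop 1)))} refl
            (seq≤ assign≤ (seq≤ (pushes h (x ∙ k) a (h ∙ l)) assign≤)))
          r)

  mutual
    compile≤ : ∀ {n} (a : Term n) {p ρ s} → Env s p ρ → Pushes (compile a p) (time a p) s (⟦ a ⟧ ρ)
    compile≤ (ref i) {p} {s = s} es =
      set≤ (cons (peek (lookup p i)) stack)
           (cong (_∙ s) (trans (cong hdᵗ (eval-drop (lookup p i) s)) (Env-lookup es i)))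
    compile≤ leaf es = assign≤
    compile≤ (pair a b) es = seq≤ (compile≤ a es) (seq≤ (compile≤ b (Env-push es)) assign≤)
    compile≤ (fst a) es = seq≤ (compile≤ a es) assign≤
    compile≤ (snd a) es = seq≤ (compile≤ a es) assign≤
    compile≤ (cond a b c) {p} {ρ} {s} es = seq≤ (compile≤ a es) (branch (⟦ a ⟧ ρ))
      where
      branch : ∀ v → (if peek 0 then (set (drop 1) ⨾ compile b p)
                                else (set (drop 1) ⨾ compile c p)) , with-stack (v ∙ s)
               ⇓≤[ suc (cost (peek 0)) + (evalCost L (setCost (drop 1) ⨾ᶜ time b p) +
                                          evalCost L (setCost (drop 1) ⨾ᶜ time c p)) ]
               with-stack (condᵗ v (⟦ b ⟧ ρ) (⟦ c ⟧ ρ) ∙ s)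
      branch nil     = if-f≤ {b = evalCost L (setCost (drop 1) ⨾ᶜ time b p)} refl (seq≤ assign≤ (compile≤ c es))
      branch (_ ∙ _) = if-t≤ {b′ = evalCost L (setCost (drop 1) ⨾ᶜ time c p)} refl (seq≤ assign≤ (compile≤ b es))
    compile≤ (bind a b) es =
      seq≤ (compile≤ a es) (seq≤ (compile≤ b (refl ∷ Env-push es)) assign≤)
    compile≤ (call {m} f as) {ρ = ρ} {s} es =
      seq≤ (compile*≤ as es)
           (seq≤ (compile≤ f (Env-positions (⟦ as ⟧* ρ) s))
                 (set≤ (cons (peek 0) (drop (suc m)))
                   (cong (⟦ f ⟧ (⟦ as ⟧* ρ) ∙_) (trans
                     (eval-drop (suc m) (⟦ f ⟧ (⟦ as ⟧* ρ) ∙ pushAll (⟦ as ⟧* ρ) s))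
                     (trans (dropᵗ-suc m _ (pushAll (⟦ as ⟧* ρ) s))
                       (trans (cong (λ k → dropᵗ k (pushAll (⟦ as ⟧* ρ) s)) (sym (+-identityʳ m)))
                              (dropᵗ-pushAll (⟦ as ⟧* ρ) 0 s)))))))
    compile≤ (fold κ l z b) {p} {ρ} {s} es =
      seq≤ (compile≤ l es)
        (seq≤ (compile≤ z (Env-push es))
          (seq≤ (set≤ (cons (var (clockVar κ)) stack) (clock-value κ))
            (seq≤ (proj₂ loop) (set≤ (cons (peek 1) (drop 3)) refl))))
      where
      clock-value : ∀ κ {t} → eval (cons (var (clockVar κ)) stack) (with-stack t) ≡ K κ ∙ t
      clock-value short = refl
      clock-value long  = refl

      loop = foldLoop≤ (compile b (0 ∷ 2 ∷ Vec.map (4 +_) p)) (time b (0 ∷ 2 ∷ Vec.map (4 +_) p))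
        (λ h a → ⟦ b ⟧ (h ∷ a ∷ ρ)) s
        (λ h k a l → compile≤ b (refl ∷ refl ∷ Env-pushAll (h ∷ k ∷ a ∷ l ∷ []) es))
        (K κ) (⟦ l ⟧ ρ) (⟦ z ⟧ ρ)
    compile≤ longClock es = assign≤

    compile*≤ : ∀ {n m} (as : Vec (Term n) m) {p ρ s} → Env s p ρ →
                compile* as p , with-stack s ⇓≤[ evalCost L (time* as p) ]
                with-stack (pushAll (⟦ as ⟧* ρ) s)
    compile*≤ []       es = assign≤
    compile*≤ {m = suc m} (a ∷ as) {ρ = ρ} es =
      seq≤ (compile*≤ as es) (compile≤ a (Env-pushAll (⟦ as ⟧* ρ) es))

-- Costs as polynomials in the lengths of the clocks

coefficient : Cost → ℕ
coefficient (con c) = c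
coefficient (p ⊕ q) = coefficient p + coefficient q
coefficient (κ ⊛ p) = coefficient p

degree : Clock → Cost → ℕ
degree κ     (con c)     = 0
degree κ     (p ⊕ q)     = degree κ p ⊔ degree κ q
degree short (short ⊛ p) = suc (degree short p)
degree short (long ⊛ p)  = degree short p
degree long  (short ⊛ p) = degree long p
degree long  (long ⊛ p)  = suc (degree long p)

module _ {L : Clock → ℕ} (L≥1 : ∀ κ → 1 ≤ L κ) where

  monomial : ℕ → ℕ → ℕ
  monomial a b = L short ^ a * L long ^ b

  pow≥1 : ∀ κ a → 1 ≤ L κ ^ a
  pow≥1 κ zero    = ≤-refl
  pow≥1 κ (suc a) = *-mono-≤ (L≥1 κ) (pow≥1 κ a)

  pow-mono : ∀ κ {a b} → a ≤ b → L κ ^ a ≤ L κ ^ b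
  pow-mono κ a≤b = ^-monoʳ-≤ (L κ) {{>-nonZero (L≥1 κ)}} a≤b

  monomial-mono : ∀ {a a′ b b′} → a ≤ a′ → b ≤ b′ → monomial a b ≤ monomial a′ b′
  monomial-mono p q = *-mono-≤ (pow-mono short p) (pow-mono long q)

  -- Both clocks have length at least 1, so raising an exponent never decreases a monomial: summands
  -- can be brought to common degrees, after which their coefficients add up.
  evalCost≤ : ∀ c → evalCost L c ≤ coefficient c * monomial (degree short c) (degree long c)
  evalCost≤ (con c) = ≤-reflexive (sym (*-identityʳ c))
  evalCost≤ (p ⊕ q) = begin
    evalCost L p + evalCost L q
      ≤⟨ +-mono-≤ (evalCost≤ p) (evalCost≤ q) ⟩
    coefficient p * monomial (degree short p) (degree long p) +
    coefficient q * monomial (degree short q) (degree long q)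
      ≤⟨ +-mono-≤
           (*-monoʳ-≤ (coefficient p) (monomial-mono {degree short p} {b = degree long p}
             (m≤m⊔n (degree short p) (degree short q)) (m≤m⊔n (degree long p) (degree long q))))
           (*-monoʳ-≤ (coefficient q) (monomial-mono {degree short q} {b = degree long q}
             (m≤n⊔m (degree short p) (degree short q)) (m≤n⊔m (degree long p) (degree long q)))) ⟩
    coefficient p * m + coefficient q * m
      ≡⟨ *-distribʳ-+ m (coefficient p) (coefficient q) ⟨
    (coefficient p + coefficient q) * m ∎
    where
    open ≤-Reasoning
    m = monomial (degree short (p ⊕ q)) (degree long (p ⊕ q))
  evalCost≤ (short ⊛ p) = begin
    L short * evalCost L p
      ≤⟨ *-monoʳ-≤ (L short) (evalCost≤ p) ⟩
    L short * (coefficient p * monomial (degree short p) (degree long p))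
      ≡⟨ rearrange (L short) (coefficient p) (L short ^ degree short p) (L long ^ degree long p) ⟩
    coefficient p * monomial (suc (degree short p)) (degree long p) ∎
    where
    open ≤-Reasoning
    rearrange : ∀ l c x y → l * (c * (x * y)) ≡ c * (l * x * y)
    rearrange = solve-∀
  evalCost≤ (long ⊛ p) = begin
    L long * evalCost L p
      ≤⟨ *-monoʳ-≤ (L long) (evalCost≤ p) ⟩
    L long * (coefficient p * monomial (degree short p) (degree long p))
      ≡⟨ rearrange (L long) (coefficient p) (L short ^ degree short p) (L long ^ degree long p) ⟩
    coefficient p * monomial (degree short p) (suc (degree long p)) ∎
    where
    open ≤-Reasoning
    rearrange : ∀ l c x y → l * (c * (x * y)) ≡ c * (x * (l * y))
    rearrange = solve-∀

-- Only the exponent of the long clock matters for the final bound. It is therefore prescribed, to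
-- be checked by computation for a concrete term, while the coefficient and the short exponent stay
-- hidden.
polynomial : ∀ c {b} → degree long c ≡ b → ∃[ m ] ∃[ a ] (∀ {L} → (∀ κ → 1 ≤ L κ) →
             evalCost L c ≤ m * (L short ^ a * L long ^ b))
polynomial c refl = coefficient c , degree short c , λ L≥1 → evalCost≤ L≥1 c

-- The long clock grows while it is built; monotonicity allows every phase to be charged at one
-- common bound.
evalCost-mono : ∀ {L L′} → (∀ κ → L κ ≤ L′ κ) → ∀ c → evalCost L c ≤ evalCost L′ c
evalCost-mono L≤ (con c) = ≤-refl
evalCost-mono L≤ (p ⊕ q) = +-mono-≤ (evalCost-mono L≤ p) (evalCost-mono L≤ q)
evalCost-mono L≤ (κ ⊛ p) = *-mono-≤ (L≤ κ) (evalCost-mono L≤ p)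

-- Construction of the clocks and the three phases of the program

shortVar longVar : Exp 3
shortVar = var (suc zero)
longVar  = var (suc (suc zero))

-- The stack holds the subtrees still to be visited, and each visit, of a leaf or an inner node,
-- ticks once. Meanwhile the variable of the long clock keeps a copy of the input; at the end it
-- receives `nil ∙ nil`, the list whose only entry is the empty tuple of states.
tick visit flattenBody flatten prepare : Cmd 3
tick        = suc zero ≔ cons nil shortVar
visit       = if peek 0 then set (cons (hd (peek 0)) (cons (tl (peek 0)) (drop 1)))
                        else set (drop 1)
flattenBody = tick ⨾ visit
flatten     = while stack loop flattenBody
prepare     = (suc (suc zero) ≔ stack) ⨾ set (cons stack nil) ⨾ flatten ⨾
              set (cons longVar nil) ⨾ (suc (suc zero) ≔ cons nil nil)

ticks : Tree → Tree → Tree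
ticks nil     c = nil ∙ c
ticks (l ∙ r) c = ticks r (ticks l (nil ∙ c))

len-ticks : ∀ t c → len (ticks t c) ≡ size t + len c
len-ticks nil     c = refl
len-ticks (l ∙ r) c = trans (len-ticks r (ticks l (nil ∙ c)))
  (trans (cong (size r +_) (len-ticks l (nil ∙ c))) (rearrange (size r) (size l) (len c)))
  where
  rearrange : ∀ r l c → r + (l + suc c) ≡ suc (l + r + c)
  rearrange = solve-∀

visitTime : ℕ
visitTime = suc (cost stack) +
  suc (suc (cost (cons nil shortVar)) +
    (suc (cost (peek 0)) + (suc (cost (cons (hd (peek 0)) (cons (tl (peek 0)) (drop 1)))) +
                            suc (cost (drop 1)))))

-- The rest of the run is a premise, so that the bound for `l ∙ r` arises by putting the run for `r`
-- inside that for `l`.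
flatten≤ : ∀ t {s c x b τ} → (flatten , s ∷ ticks t c ∷ x ∷ [] ⇓≤[ b ] τ) →
           flatten , t ∙ s ∷ c ∷ x ∷ [] ⇓≤[ visitTime * size t + b ] τ
flatten≤ nil     r = loop-t≤ refl
  (seq≤ assign≤ (if-f≤ {b = suc (cost (cons (hd (peek 0)) (cons (tl (peek 0)) (drop 1))))} refl assign≤)) r
flatten≤ (l ∙ r) {b = b} h =
  weaken≤ (≤-reflexive (rearrange visitTime (size l) (size r) b))
    (loop-t≤ refl (seq≤ assign≤ (if-t≤ {b′ = suc (cost (drop 1))} refl assign≤))
      (flatten≤ l (flatten≤ r h)))
  where
  rearrange : ∀ v l r b → v + (v * l + (v * r + b)) ≡ v * suc (l + r) + b
  rearrange = solve-∀

prepareTime : Cost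
prepareTime =
  setCost stack ⨾ᶜ setCost (cons stack nil) ⨾ᶜ
  (short ⊛ con visitTime ⊕ con (suc (cost stack))) ⨾ᶜ
  setCost (cons longVar nil) ⨾ᶜ setCost (cons nil nil)

module _ (sets cross main : Term 1) where

  popSet crossBody crossLoop : Cmd 3
  popSet    = set (cons (hd (peek 0)) (cons (tl (peek 0)) (drop 1)))
  crossBody = popSet ⨾ compile cross (0 ∷ []) ⨾ (suc (suc zero) ≔ peek 0) ⨾ set (drop 2)
  crossLoop = while peek 0 loop crossBody

  threePhases : Cmd 3
  -- `main` finds the input at position 1, below the exhausted list of sets.
  threePhases = prepare ⨾ compile sets (0 ∷ []) ⨾ crossLoop ⨾ compile main (1 ∷ []) ⨾ set (peek 0)

  clocks : Tree → Tree → Clock → Tree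
  clocks k c short = k
  clocks k c long  = c

  -- Each crossing has the list built so far as its long clock, and its result is the long clock of
  -- the next one.
  crossed : Tree → Tree → Tree → Tree
  crossed k nil     c = c
  crossed k (S ∙ r) c = crossed k r (Semantics.⟦_⟧ (clocks k c) cross (S ∷ []))

  -- The long clock never exceeds M while the sets are processed.
  Below : ℕ → Tree → Tree → Tree → Set
  Below M k nil     c = len c ≤ M
  Below M k (S ∙ r) c = len c ≤ M × Below M k r (Semantics.⟦_⟧ (clocks k c) cross (S ∷ []))

  crossTime : Cost
  crossTime = con (suc (cost (peek 0))) ⊕
    (setCost (cons (hd (peek 0)) (cons (tl (peek 0)) (drop 1))) ⨾ᶜ time cross (0 ∷ []) ⨾ᶜ
     setCost (peek 0) ⨾ᶜ setCost (drop 2))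

  lengths : Tree → ℕ → Clock → ℕ
  lengths k M short = len k
  lengths k M long  = M

  clocks≤ : ∀ k {c M} → len c ≤ M → ∀ κ → len (clocks k c κ) ≤ lengths k M κ
  clocks≤ k c≤M short = ≤-refl
  clocks≤ k c≤M long  = c≤M

  crossLoop≤ : ∀ {M k s} S c → Below M k S c →
    crossLoop , S ∙ s ∷ k ∷ c ∷ []
      ⇓≤[ len S * evalCost (lengths k M) crossTime + suc (cost (peek 0)) ]
      nil ∙ s ∷ k ∷ crossed k S c ∷ []
  crossLoop≤ nil     c below = loop-f≤ refl
  crossLoop≤ {M} {k} {s} (S ∙ r) c (c≤M , below) =
    weaken≤ (≤-trans (+-monoˡ-≤ _ (evalCost-mono (clocks≤ k c≤M) crossTime))
                     (≤-reflexive (sym (+-assoc (evalCost (lengths k M) crossTime) _ _))))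
      (loop-t≤ refl
        (seq≤ assign≤ (seq≤ (compile≤ cross (refl ∷ [])) (seq≤ assign≤ assign≤)))
        (crossLoop≤ r _ below))
    where open Soundness (clocks k c)

  totalTime : Cost
  totalTime = prepareTime ⨾ᶜ time sets (0 ∷ []) ⨾ᶜ
    (short ⊛ crossTime ⊕ con (suc (cost (peek 0)))) ⨾ᶜ
    time main (1 ∷ []) ⨾ᶜ setCost (peek 0)

  -- The short clock has the size of the input as its length, the long one
  -- is the list computed by crossing.
  module _ (x : Tree) where

    shortTree setsTree longTree : Tree
    shortTree = ticks x nil
    setsTree  = Semantics.⟦_⟧ (clocks shortTree (nil ∙ nil)) sets (x ∷ [])
    longTree  = crossed shortTree setsTree (nil ∙ nil)

    len-shortTree : len shortTree ≡ size x
    len-shortTree = trans (len-ticks x nil) (+-identityʳ (size x))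

    threePhases≤ : ∀ {M} → 1 ≤ M → Below M shortTree setsTree (nil ∙ nil) →
      len longTree ≤ M → len setsTree ≤ len shortTree →
      ∃[ τ ] (threePhases , x ∷ nil ∷ nil ∷ []
        ⇓≤[ evalCost (lengths shortTree M) totalTime ]
        Semantics.⟦_⟧ (clocks shortTree longTree) main (x ∷ []) ∷ τ)
    threePhases≤ {M} 1≤M below long≤M sets≤ = _ ,
      seq≤ (seq≤ assign≤ (seq≤ assign≤ (seq≤ flatten′ (seq≤ assign≤ assign≤))))
        (seq≤ (mono {nil ∙ nil} 1≤M (time sets (0 ∷ []))
                (Soundness.compile≤ (clocks shortTree (nil ∙ nil)) sets (refl ∷ [])))
          (seq≤ (weaken≤ (+-monoˡ-≤ (suc (cost (peek 0)))
                           (*-monoˡ-≤ (evalCost (lengths shortTree M) crossTime) sets≤))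
                         (crossLoop≤ setsTree (nil ∙ nil) below))
            (seq≤ (mono {longTree} long≤M (time main (1 ∷ []))
                    (Soundness.compile≤ (clocks shortTree longTree) main (refl ∷ [])))
                  assign≤)))
      where
      mono : ∀ {c C σ τ} → len c ≤ M → ∀ p →
             (C , σ ⇓≤[ evalCost (λ κ → len (clocks shortTree c κ)) p ] τ) →
             C , σ ⇓≤[ evalCost (lengths shortTree M) p ] τ
      mono c≤M p = weaken≤ (evalCost-mono (clocks≤ shortTree c≤M) p)

      flatten′ : flatten , x ∙ nil ∷ nil ∷ x ∷ []
        ⇓≤[ evalCost (lengths shortTree M) (short ⊛ con visitTime ⊕ con (suc (cost stack))) ]
        nil ∷ shortTree ∷ x ∷ []
      flatten′ = weaken≤
        (≤-reflexive (cong (_+ suc (cost stack))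
          (trans (*-comm visitTime (size x)) (cong (_* visitTime) (sym len-shortTree)))))
        (flatten≤ x (loop-f≤ refl))

-- Reachability by stages

data Mark : Set where
  unseen next current done : Mark

shift : Mark → Mark
shift unseen  = unseen
shift next    = current
shift current = current
shift done    = done

-- Active marks are for nodes known to be reached in a stage already begun, seen ones for nodes
-- known to be possible starts of the next stage.
data Active : Mark → Set where
  current : Active current
  done    : Active done

data Seen : Mark → Set where
  next   : Seen next
  active : ∀ {m} → Active m → Seen m

weight : Mark → ℕ
weight done = 0
weight _    = 1

-- Succ are the moves within a stage; Same is a change of the writer, which
-- starts a new stage.
module Search {Node : Set} (Succ Same : Node → Node → Set) (Init : Node → Set)
              (same-refl : ∀ x → Same x x) where

  -- Available j x: after j stages, the next one can start at x.
  -- Reached j x: x can be visited within the first j stages.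
  mutual
    data Available : ℕ → Node → Set where
      init  : ∀ {j x} → Init x → Available j x
      leave : ∀ {j x y} → Reached j x → Same x y → Available j y

    data Reached : ℕ → Node → Set where
      start : ∀ {j x} → Available j x → Reached (suc j) x
      move  : ∀ {j x y} → Reached j x → Succ x y → Reached j y

  mutual
    Available-suc : ∀ {j x} → Available j x → Available (suc j) x
    Available-suc (init i)    = init i
    Available-suc (leave r s) = leave (Reached-suc r) s

    Reached-suc : ∀ {j x} → Reached j x → Reached (suc j) x
    Reached-suc (start a)  = start (Available-suc a)
    Reached-suc (move r s) = move (Reached-suc r) s

  Available-+ : ∀ k {j x} → Available j x → Available (k + j) x
  Available-+ zero    a = a
  Available-+ (suc k) a = Available-suc (Available-+ k a)

  -- The constructors follow the order of the tests made when `x` is explored. The premises `x ≢ y`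
  -- exclude that `x` itself stays current, which is what makes a round reduce the number of pending
  -- nodes.
  data Relaxed (x y : Node) : Mark → Mark → Set where
    hit          : ∀ {m} → x ≡ y → Relaxed x y m done
    keep-done    : Relaxed x y done done
    keep-current : x ≢ y → Relaxed x y current current
    reach        : ∀ {m} → x ≢ y → m ≢ done → Succ x y → Relaxed x y m current
    keep-next    : ¬ Succ x y → Relaxed x y next next
    discover     : ¬ Succ x y → Same x y → Relaxed x y unseen next
    ignore       : ¬ Succ x y → ¬ Same x y → Relaxed x y unseen unseen

  module _ {x y : Node} where

    Relaxed-active : ∀ {m m′} → Relaxed x y m m′ → Active m → Active m′
    Relaxed-active (hit _)      _ = done
    Relaxed-active keep-done    _ = done
    Relaxed-active (keep-current _) _ = current
    Relaxed-active (reach _ _ _)  _ = current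

    Relaxed-seen : ∀ {m m′} → Relaxed x y m m′ → Seen m → Seen m′
    Relaxed-seen r              (active a) = active (Relaxed-active r a)
    Relaxed-seen (hit _)        next       = active done
    Relaxed-seen (reach _ _ _)    next       = active current
    Relaxed-seen (keep-next _)  next       = next

    Relaxed-succ : ∀ {m m′} → Relaxed x y m m′ → Succ x y → Active m′
    Relaxed-succ (hit _)          s = done
    Relaxed-succ keep-done        s = done
    Relaxed-succ (keep-current _)     s = current
    Relaxed-succ (reach _ _ _)      s = current
    Relaxed-succ (keep-next ¬s)   s = ⊥-elim (¬s s)
    Relaxed-succ (discover ¬s _)  s = ⊥-elim (¬s s)
    Relaxed-succ (ignore ¬s _)    s = ⊥-elim (¬s s)

    Relaxed-same : ∀ {m m′} → Relaxed x y m m′ → Same x y → Seen m′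
    Relaxed-same (hit _)          s = active done
    Relaxed-same keep-done        s = active done
    Relaxed-same (keep-current _)     s = active current
    Relaxed-same (reach _ _ _)      s = active current
    Relaxed-same (keep-next _)    s = next
    Relaxed-same (discover _ _)   s = next
    Relaxed-same (ignore _ ¬s)    s = ⊥-elim (¬s s)

    Relaxed-weight : ∀ {m m′} → Relaxed x y m m′ → weight m′ ≤ weight m
    Relaxed-weight (hit _)        = z≤n
    Relaxed-weight keep-done      = z≤n
    Relaxed-weight (keep-current _)   = ≤-refl
    Relaxed-weight (reach {unseen} _ _ _) = ≤-refl
    Relaxed-weight (reach {next} _ _ _) = ≤-refl
    Relaxed-weight (reach {current} _ _ _) = ≤-refl
    -- The only case in which the weight would rise; the premise of `reach` excludes it.
    Relaxed-weight (reach {done} _ d _) = ⊥-elim (d refl)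
    Relaxed-weight (keep-next _)  = ≤-refl
    Relaxed-weight (discover _ _) = ≤-refl
    Relaxed-weight (ignore _ _)   = ≤-refl

  Marking : Set
  Marking = Node → Mark

  Justified : ℕ → Node → Mark → Set
  Justified j x unseen  = ⊤
  Justified j x next    = Available j x
  Justified j x current = Reached j x
  Justified j x done    = Reached j x

  -- j stages have been started and k remain.
  record Invariant (s j k : ℕ) (μ : Marking) : Set where
    field
      stages     : k + j ≡ s
      justified  : ∀ x → Justified j x (μ x)
      succ-close : ∀ {x y} → μ x ≡ done → Succ x y → Active (μ y)
      same-close : ∀ {x y} → μ x ≡ done → Same x y → Seen (μ y)
      initial    : ∀ {x} → Init x → Seen (μ x)
      complete   : ∀ {i x} → j ≡ suc i → Available i x → Active (μ x)

  NoCurrent NoNext : Marking → Set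
  NoCurrent μ = ∀ x → μ x ≢ current
  NoNext μ    = ∀ x → μ x ≢ next

  Active⇒done : ∀ {m} → m ≢ current → Active m → m ≡ done
  Active⇒done c current = ⊥-elim (c refl)
  Active⇒done c done    = refl

  Seen⇒done : ∀ {m} → m ≢ current → m ≢ next → Seen m → m ≡ done
  Seen⇒done c n next       = ⊥-elim (n refl)
  Seen⇒done c n (active a) = Active⇒done c a

  module _ {s j k : ℕ} {μ : Marking} (I : Invariant s j k μ) (nc : NoCurrent μ) where
    open Invariant I

    -- With no current node left the stage is exhausted: `complete` makes its starting nodes done,
    -- and `succ-close` keeps all moves among the done nodes.
    Reached⇒done : ∀ {x} → Reached j x → μ x ≡ done
    Reached⇒done (start a)     = Active⇒done (nc _) (complete refl a)
    Reached⇒done (move r x→y) =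
      Active⇒done (nc _) (succ-close (Reached⇒done r) x→y)

    Available⇒Seen : ∀ {x} → Available j x → Seen (μ x)
    Available⇒Seen (init i)    = initial i
    Available⇒Seen (leave r e) = same-close (Reached⇒done r) e

    module _ (nn : NoNext μ) where

      mutual
        -- Without next nodes the done nodes contain the initial ones and are closed under both
        -- relations, so the number `i` of stages is arbitrary here. This is why stages left over
        -- can be ignored.
        Available⇒done : ∀ {i x} → Available i x → μ x ≡ done
        Available⇒done (init i)    = Seen⇒done (nc _) (nn _) (initial i)
        Available⇒done (leave r e) = Seen⇒done (nc _) (nn _) (same-close (Reached⇒done′ r) e)

        Reached⇒done′ : ∀ {i x} → Reached i x → μ x ≡ done
        Reached⇒done′ (start a)    = Available⇒done a
        Reached⇒done′ (move r x→y) = Active⇒done (nc _) (succ-close (Reached⇒done′ r) x→y)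

  shift-active : ∀ {m} → Active m → Active (shift m)
  shift-active current = current
  shift-active done    = done

  shift-seen : ∀ {m} → Seen m → Active (shift m)
  shift-seen next       = current
  shift-seen (active a) = shift-active a

  shift-done : ∀ m → shift m ≡ done → m ≡ done
  shift-done done refl = refl

  shift-justified : ∀ {j x} m → Justified j x m → Justified (suc j) x (shift m)
  shift-justified unseen  _ = tt
  shift-justified next    a = start a
  shift-justified current r = Reached-suc r
  shift-justified done    r = Reached-suc r

  -- The new `complete` is `Available⇒Seen` for the old marking, which needs the old stage to be
  -- exhausted; hence no shift before the last current node is done.
  Invariant-shift : ∀ {s j k μ} → NoCurrent μ → Invariant s j (suc k) μ →
                    Invariant s (suc j) k (shift ∘ μ)
  Invariant-shift {j = j} {k} {μ} nc I = record
    { stages     = trans (+-suc k j) stages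
    ; justified  = λ x → shift-justified (μ x) (justified x)
    ; succ-close = λ {x} d e → shift-active (succ-close (shift-done (μ x) d) e)
    ; same-close = λ {x} d e → active (shift-seen (same-close (shift-done (μ x) d) e))
    ; initial    = λ i → active (shift-seen (initial i))
    ; complete   = λ { refl a → shift-seen (Available⇒Seen I nc a) }
    }
    where open Invariant I

  module _ {s j k : ℕ} {μ μ′ : Marking} {x : Node} (x-current : μ x ≡ current)
           (relaxed : ∀ y → Relaxed x y (μ y) (μ′ y)) (I : Invariant s j k μ) where
    open Invariant I

    Reached-current : Reached j x
    Reached-current = subst (Justified j x) x-current (justified x)

    relaxed-justified : ∀ {y m m′} → Relaxed x y m m′ → Justified j y m → Justified j y m′
    relaxed-justified (hit refl)     _ = Reached-current
    relaxed-justified keep-done      r = r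
    relaxed-justified (keep-current _)   r = r
    relaxed-justified (reach _ _ s)    _ = move Reached-current s
    relaxed-justified (keep-next _)  a = a
    relaxed-justified (discover _ s) _ = leave Reached-current s
    relaxed-justified (ignore _ _)   _ = tt

    -- The done nodes gain at most `x`, so the closure properties need a new argument only for the
    -- edges that leave `x`.
    relaxed-done : ∀ {y m m′} → Relaxed x y m m′ → m′ ≡ done → x ≡ y ⊎ m ≡ done
    relaxed-done (hit e)   _ = inj₁ e
    relaxed-done keep-done _ = inj₂ refl

    Invariant-relax : Invariant s j k μ′
    Invariant-relax = record
      { stages     = stages
      ; justified  = λ y → relaxed-justified (relaxed y) (justified y)
      ; succ-close = λ {y} {z} d e → succ-close′ (relaxed-done (relaxed y) d) e
      ; same-close = λ {y} {z} d e → same-close′ (relaxed-done (relaxed y) d) e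
      ; initial    = λ i → Relaxed-seen (relaxed _) (initial i)
      ; complete   = λ e a → Relaxed-active (relaxed _) (complete e a)
      }
      where
      succ-close′ : ∀ {y z} → x ≡ y ⊎ μ y ≡ done → Succ y z → Active (μ′ z)
      succ-close′ (inj₁ refl) e = Relaxed-succ (relaxed _) e
      succ-close′ (inj₂ d)    e = Relaxed-active (relaxed _) (succ-close d e)

      same-close′ : ∀ {y z} → x ≡ y ⊎ μ y ≡ done → Same y z → Seen (μ′ z)
      same-close′ (inj₁ refl) e = Relaxed-same (relaxed _) e
      same-close′ (inj₂ d)    e = Relaxed-seen (relaxed _) (same-close d e)

  -- The two situations in which the marking already gives the answer: the budget of stages is
  -- spent, or no further stage has a new node to start from.
  Stuck : Marking → ℕ → Set
  Stuck μ k = NoCurrent μ × (k ≡ 0 ⊎ NoNext μ)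

  justified-seen : ∀ {j x m} → Justified j x m → Seen m → Available j x
  justified-seen a next             = a
  -- Leaving a node for itself turns a visit within a stage into a start of the next one.
  justified-seen r (active current) = leave r (same-refl _)
  justified-seen r (active done)    = leave r (same-refl _)

  Stuck⇒correct : ∀ {s j k μ} → Invariant s j k μ → Stuck μ k →
                  ∀ x → Seen (μ x) ⇔ Available s x
  Stuck⇒correct {s} {j} {k} {μ} I (nc , e) x = mk⇔ sound (λ a → seen e a)
    where
    open Invariant I

    sound : Seen (μ x) → Available s x
    sound v = subst (λ n → Available n x) stages (Available-+ k (justified-seen (justified x) v))

    seen : k ≡ 0 ⊎ NoNext μ → Available s x → Seen (μ x)
    seen (inj₁ refl) a = Available⇒Seen I nc (subst (λ n → Available n x) (sym stages) a)
    seen (inj₂ nn)   a = subst Seen (sym (Available⇒done I nc nn a)) (active done)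

  data Round : Marking → ℕ → Marking → ℕ → Set where
    relax       : ∀ {μ μ′ k x} → μ x ≡ current → (∀ y → Relaxed x y (μ y) (μ′ y)) →
                  Round μ k μ′ k
    shift-relax : ∀ {μ μ′ k x} → NoCurrent μ → shift (μ x) ≡ current →
                  (∀ y → Relaxed x y (shift (μ y)) (μ′ y)) → Round μ (suc k) μ′ k
    shift-only  : ∀ {μ k} → NoCurrent μ → NoCurrent (shift ∘ μ) → Round μ (suc k) (shift ∘ μ) k
    stop        : ∀ {μ} → NoCurrent μ → Round μ 0 μ 0

  module _ (nodes : List Node) (all-nodes : ∀ x → x ∈ nodes) where

    pendingIn : List Node → Marking → ℕ
    pendingIn []       μ = 0
    pendingIn (x ∷ xs) μ = weight (μ x) + pendingIn xs μ

    pending : Marking → ℕ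
    pending = pendingIn nodes

    pendingIn≤length : ∀ xs μ → pendingIn xs μ ≤ length xs
    pendingIn≤length []       μ = z≤n
    pendingIn≤length (x ∷ xs) μ = +-mono-≤ (weight≤1 (μ x)) (pendingIn≤length xs μ)
      where
      weight≤1 : ∀ m → weight m ≤ 1
      weight≤1 unseen  = ≤-refl
      weight≤1 next    = ≤-refl
      weight≤1 current = ≤-refl
      weight≤1 done    = z≤n

    pendingIn-mono : ∀ xs {μ μ′} → (∀ y → weight (μ′ y) ≤ weight (μ y)) →
                     pendingIn xs μ′ ≤ pendingIn xs μ
    pendingIn-mono []       h = z≤n
    pendingIn-mono (x ∷ xs) h = +-mono-≤ (h x) (pendingIn-mono xs h)

    pendingIn-strict : ∀ xs {μ μ′ x} → x ∈ xs → (∀ y → weight (μ′ y) ≤ weight (μ y)) →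
                       weight (μ′ x) < weight (μ x) → pendingIn xs μ′ < pendingIn xs μ
    pendingIn-strict (x ∷ xs) (here refl) h l = +-mono-<-≤ l (pendingIn-mono xs h)
    pendingIn-strict (x ∷ xs) (there x∈)  h l = +-mono-≤-< (h x) (pendingIn-strict xs x∈ h l)

    pendingIn-zero : ∀ xs {μ x} → x ∈ xs → pendingIn xs μ ≤ 0 → μ x ≡ done
    pendingIn-zero (x ∷ xs) {μ} (here refl) p = weightless (μ x) (≤-trans (m≤m+n _ _) p)
      where
      weightless : ∀ m → weight m ≤ 0 → m ≡ done
      weightless done _ = refl
    pendingIn-zero (x ∷ xs) {μ} (there x∈) p =
      pendingIn-zero xs x∈ (≤-trans (m≤n+m _ (weight (μ x))) p)

    relax-pending : ∀ {μ μ′ x} → μ x ≡ current → (∀ y → Relaxed x y (μ y) (μ′ y)) →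
                    pending μ′ < pending μ
    relax-pending {μ} {μ′} {x} c r =
      pendingIn-strict nodes (all-nodes x) (λ y → Relaxed-weight (r y))
        (strict (r x) c)
      where
      strict : ∀ {m m′} → Relaxed x x m m′ → m ≡ current → weight m′ < weight m
      strict (hit _)          refl = ≤-refl
      strict (keep-current ≢) refl = ⊥-elim (≢ refl)
      strict (reach ≢ _ _)    refl = ⊥-elim (≢ refl)

    -- With `n` rounds to go. A round explores a pending node or ends stuck, and the rounds possible
    -- in a stuck search keep it stuck; so the disjunction survives when `n` decreases.
    Progress : ℕ → ℕ → Marking → ℕ → Set
    Progress s n μ k = (∃[ j ] Invariant s j k μ) × (pending μ ≤ n ⊎ Stuck μ k)

    weight-shift : ∀ m → weight (shift m) ≤ weight m
    weight-shift unseen  = ≤-refl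
    weight-shift next    = ≤-refl
    weight-shift current = ≤-refl
    weight-shift done    = ≤-refl

    shift-≢next : ∀ m → shift m ≢ next
    shift-≢next unseen  ()
    shift-≢next next    ()
    shift-≢next current ()
    shift-≢next done    ()

    shift-≢current : ∀ {m} → m ≢ current → m ≢ next → shift m ≢ current
    shift-≢current {next}    c n _ = n refl
    shift-≢current {current} c n _ = c refl

    Progress-round : ∀ {s n μ k μ′ k′} → Round μ k μ′ k′ →
                     Progress s (suc n) μ k → Progress s n μ′ k′
    Progress-round (relax c r) ((j , I) , p) = (j , Invariant-relax c r I) , fewer p
      where
      fewer : _ → _
      fewer (inj₁ p)        = inj₁ (≤-pred (≤-trans (relax-pending c r) p))
      fewer (inj₂ (nc , _)) = ⊥-elim (nc _ c)
    Progress-round (shift-relax {μ} nc c r) ((j , I) , p) =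
      (suc j , Invariant-relax c r (Invariant-shift nc I)) , fewer p
      where
      fewer : _ → _
      fewer (inj₁ p) = inj₁ (≤-pred (≤-trans (relax-pending {shift ∘ μ} c r)
        (≤-trans (pendingIn-mono nodes (λ y → weight-shift (μ y))) p)))
      -- A stuck search with stages left has no next node, so the shift cannot have produced a
      -- current one.
      fewer (inj₂ (_ , inj₂ nn)) = ⊥-elim (shift-≢current (nc _) (nn _) c)
    -- No node is next after a shift; if none is current either, the search is stuck whatever the
    -- number of remaining stages.
    Progress-round (shift-only {μ} nc nc′) ((j , I) , p) =
      (suc j , Invariant-shift nc I) , inj₂ (nc′ , inj₂ (λ y → shift-≢next (μ y)))
    Progress-round (stop nc) (I , p) = I , inj₂ (nc , inj₁ refl)

    Progress-initial : ∀ s {μ} → (∀ x → (Init x × μ x ≡ next) ⊎ (¬ Init x × μ x ≡ unseen)) →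
                       Progress s (length nodes) μ s
    Progress-initial s {μ} h = (0 , record
      { stages     = +-identityʳ s
      ; justified  = λ x → justified x (h x)
      ; succ-close = λ {x} d _ → ⊥-elim (not-done (h x) d)
      ; same-close = λ {x} d _ → ⊥-elim (not-done (h x) d)
      ; initial    = λ {x} i → initial i (h x)
      -- Vacuous, as no stage has been started.
      ; complete   = λ ()
      }) , inj₁ (pendingIn≤length nodes μ)
      where
      justified : ∀ x → (Init x × μ x ≡ next) ⊎ (¬ Init x × μ x ≡ unseen) → Justified 0 x (μ x)
      justified x (inj₁ (i , e)) = subst (Justified 0 x) (sym e) (init i)
      justified x (inj₂ (_ , e)) = subst (Justified 0 x) (sym e) tt

      not-done : ∀ {x} → (Init x × μ x ≡ next) ⊎ (¬ Init x × μ x ≡ unseen) → μ x ≢ done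
      not-done (inj₁ (_ , e)) d with () ← trans (sym e) d
      not-done (inj₂ (_ , e)) d with () ← trans (sym e) d

      initial : ∀ {x} → Init x → (Init x × μ x ≡ next) ⊎ (¬ Init x × μ x ≡ unseen) → Seen (μ x)
      initial i (inj₁ (_ , e))  = subst Seen (sym e) next
      initial i (inj₂ (¬i , _)) = ⊥-elim (¬i i)

    Progress-final : ∀ {s μ k} → Progress s 0 μ k → ∀ x → Seen (μ x) ⇔ Available s x
    Progress-final ((_ , I) , inj₂ st) = Stuck⇒correct I st
    Progress-final {μ = μ} ((_ , I) , inj₁ p) =
      Stuck⇒correct I ((λ x → not-done (all-done x) λ ()) , inj₂ (λ x → not-done (all-done x) λ ()))
      where
      all-done : ∀ x → μ x ≡ done
      all-done x = pendingIn-zero nodes (all-nodes x) p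

      not-done : ∀ {m m′} → m ≡ done → m′ ≢ done → m ≢ m′
      not-done e n refl = n e

-- Staged computations of a program as a search

module _ (A : Program) where
  open Program A

  Node : Set
  Node = Fin t × Fin d × PC threads

  config : Node → Config A
  config (i , a , pc) = pc , a

  Succ Same : Node → Node → Set
  Succ x y = proj₁ x ≡ proj₁ y ×
             Σ[ st ∈ Step A (config x) (config y) ] WritesOnlyBy A (proj₁ x) st
  Same x y = config x ≡ config y

  Init : Node → Set
  Init x = config x ≡ c⁰ A

  open Search Succ Same Init (λ _ → refl)

  Staged : ℕ → Config A → Config A → Set
  Staged s c c′ = Σ[ γ ∈ Computation A c c′ ] IsStaged A s γ

  Stage : Fin t → Config A → Config A → Set
  Stage i c c′ = Σ[ γ ∈ Computation A c c′ ] OnlyWriter A i γ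

  -- The search appends stages and steps at the end of a computation, whereas `IsStaged` and `Star`
  -- are built from the front.
  snocStaged : ∀ {s c c′ c″ i} → Staged s c c′ → Stage i c′ c″ → Staged (suc s) c c″
  snocStaged (_ , [])      (δ , w) = _ , ((_ , w) ∷ [])
  snocStaged (_ , g ∷ gs) st = _ , (g ∷ proj₂ (snocStaged (_ , gs) st))

  snocStage : ∀ {i c c′ c″} → Stage i c c′ → (st : Step A c′ c″) → WritesOnlyBy A i st →
              Stage i c c″
  snocStage (ε , _)       st w = st ◅ ε , w , tt
  snocStage (x ◅ γ , v , vs) st w =
    let γ′ , ws = snocStage (γ , vs) st w in x ◅ γ′ , v , ws

  mutual
    Available⇒Staged : ∀ {j x} → Available j x → Staged j (c⁰ A) (config x)
    Available⇒Staged {j} {i , _} (init refl) = idle j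
      where
      idle : ∀ j → Staged j (c⁰ A) (c⁰ A)
      idle zero    = _ , []
      -- The padding consists of empty stages, charged to the writer of the node.
      idle (suc j) = _ , (_∷_ {γ = ε} (i , tt) (proj₂ (idle j)))
    Available⇒Staged (leave r refl) =
      let _ , c , e , γ , δ = Reached⇒Staged r in subst (λ n → Staged n _ _) (sym e) (snocStaged γ δ)

    -- The stage in progress is kept apart, as moves still extend it; `leave` closes it.
    Reached⇒Staged : ∀ {j x} → Reached j x →
      ∃[ i ] ∃[ c ] (j ≡ suc i × Staged i (c⁰ A) c × Stage (proj₁ x) c (config x))
    Reached⇒Staged (start a) = _ , _ , refl , Available⇒Staged a , ε , tt
    Reached⇒Staged (move r (refl , st , w)) =
      let i , c , e , γ , δ = Reached⇒Staged r in i , c , e , γ , snocStage δ st w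

  -- The writer may be changed freely between stages, so the last configuration is available with
  -- every writer `i`. The induction uses this freedom to pick the writer of the following stage.
  Staged⇒Available : ∀ {s c} → Staged s (c⁰ A) c → ∀ i → Available s (i , proj₂ c , proj₁ c)
  Staged⇒Available {s} (γ , staged) i =
    subst (λ n → Available n _) (+-identityʳ s) (go staged (λ i → init refl) i)
    where
    stage : ∀ {i c c′ j} (γ : Computation A c c′) → OnlyWriter A i γ →
            Reached j (i , proj₂ c , proj₁ c) → Reached j (i , proj₂ c′ , proj₁ c′)
    stage ε       _        r = r
    stage (x ◅ γ) (w , ws) r = stage γ ws (move r (refl , x , w))

    go : ∀ {s c c′ j} {γ : Computation A c c′} → IsStaged A s γ →
         (∀ i → Available j (i , proj₂ c , proj₁ c)) →
         ∀ i → Available (s + j) (i , proj₂ c′ , proj₁ c′)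
    go []               h i = h i
    go {suc s} {c′ = c′} {j} ((w , only) ∷ gs) h i =
      subst (λ n → Available n (i , proj₂ c′ , proj₁ c′)) (+-suc s j)
        (go gs (λ i → leave (stage _ only (start (h w))) refl) i)

-- The decision procedure

pattern v0 = ref zero
pattern v1 = ref (suc zero)
pattern v2 = ref (suc (suc zero))
pattern v3 = ref (suc (suc (suc zero)))
pattern v4 = ref (suc (suc (suc (suc zero))))
pattern v5 = ref (suc (suc (suc (suc (suc zero)))))
pattern v6 = ref (suc (suc (suc (suc (suc (suc zero))))))
pattern v7 = ref (suc (suc (suc (suc (suc (suc (suc zero)))))))

truth : ∀ {n} → Term n
truth = pair leaf leaf

infixr 6 _and_
_and_ : ∀ {n} → Term n → Term n → Term n
a and b = cond a b leaf

-- Loops run from the left only, so the inner fold reverses the list. The two folds follow each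
-- other instead of nesting, hence the degree of the cost does not grow.
foldr : ∀ {n} → Clock → Term n → Term n → Term (2 + n) → Term n
foldr κ l z b = fold κ (fold κ l leaf (pair v0 v1)) z b

data Decides (P : Set) : Tree → Set where
  yes : ∀ {l r} → P → Decides P (l ∙ r)
  no  : ¬ P → Decides P nil

module _ {P Q : Set} where

  Decides-⇔ : ∀ {s} → (P → Q) → (Q → P) → Decides P s → Decides Q s
  Decides-⇔ f g (yes p) = yes (f p)
  Decides-⇔ f g (no ¬p) = no (¬p ∘ g)

  Decides-and : ∀ {s t} → Decides P s → Decides Q t → Decides (P × Q) (condᵗ s t nil)
  Decides-and (yes p) (yes q) = yes (p , q)
  Decides-and (yes p) (no ¬q) = no (¬q ∘ proj₂)
  Decides-and (no ¬p) _       = no (¬p ∘ proj₁)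

  Decides-or : ∀ {s t} → Decides P s → Decides Q t → Decides (P ⊎ Q) (condᵗ s (nil ∙ nil) t)
  Decides-or (yes p) _       = yes (inj₁ p)
  Decides-or (no ¬p) (yes q) = yes (inj₂ q)
  Decides-or (no ¬p) (no ¬q) = no λ { (inj₁ p) → ¬p p ; (inj₂ q) → ¬q q }

Decides⇒⇔ : ∀ {P s} → Decides P s → isTrue s ≡ true ⇔ P
Decides⇒⇔ (yes p) = mk⇔ (λ _ → p) (λ _ → refl)
Decides⇒⇔ (no ¬p) = mk⇔ (λ ()) (λ p → ⊥-elim (¬p p))

foldlᵗ foldrᵗ : (Tree → Tree → Tree) → Tree → Tree → Tree
foldlᵗ f a nil     = a
foldlᵗ f a (h ∙ t) = foldlᵗ f (f h a) t
foldrᵗ f a nil     = a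
foldrᵗ f a (h ∙ t) = f h (foldrᵗ f a t)

foldᵗ≡foldlᵗ : ∀ k l {f a} → len l ≤ len k → foldᵗ k l f a ≡ foldlᵗ f a l
foldᵗ≡foldlᵗ nil     nil     p       = refl
foldᵗ≡foldlᵗ (_ ∙ k) nil     p       = refl
foldᵗ≡foldlᵗ (_ ∙ k) (h ∙ l) (s≤s p) = foldᵗ≡foldlᵗ k l p

len-reverse : ∀ l a → len (foldlᵗ _∙_ a l) ≡ len l + len a
len-reverse nil     a = refl
len-reverse (h ∙ l) a = trans (len-reverse l (h ∙ a)) (+-suc (len l) (len a))

foldlᵗ-reverse : ∀ l {a f z} → foldlᵗ f z (foldlᵗ _∙_ a l) ≡ foldlᵗ f (foldrᵗ f z l) a
foldlᵗ-reverse nil     = refl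
foldlᵗ-reverse (h ∙ l) = foldlᵗ-reverse l

foldᵗ≡foldrᵗ : ∀ k l {f z} → len l ≤ len k → foldᵗ k (foldᵗ k l _∙_ nil) f z ≡ foldrᵗ f z l
foldᵗ≡foldrᵗ k l {f} {z} p
  rewrite foldᵗ≡foldlᵗ k l {_∙_} {nil} p =
  trans (foldᵗ≡foldlᵗ k (foldlᵗ _∙_ nil l)
          (≤-trans (≤-reflexive (trans (len-reverse l nil) (+-identityʳ (len l)))) p))
        (foldlᵗ-reverse l)

module _ {A : Set} (f : A → Tree) where

  len-encodeList : ∀ xs → len (encodeList f xs) ≡ length xs
  len-encodeList []       = refl
  len-encodeList (x ∷ xs) = cong suc (len-encodeList xs)

  foldrᵗ-map : ∀ {g h} → (∀ x a → g (f x) a ≡ h x ∙ a) → ∀ xs →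
               foldrᵗ g nil (encodeList f xs) ≡ encodeList h xs
  foldrᵗ-map e []       = refl
  foldrᵗ-map e (x ∷ xs) = trans (e x _) (cong (_ ∙_) (foldrᵗ-map e xs))

  -- `Q` stands for whatever the accumulator decides so far, as a fold from the left changes its
  -- start value in the induction.
  foldlᵗ-any : ∀ {P : A → Set} {Q : Set} {g : Tree → Tree} {a} xs →
    (∀ x → Decides (P x) (g (f x))) → Decides Q a →
    Decides (Q ⊎ Any P xs) (foldlᵗ (λ h a → condᵗ (g h) (nil ∙ nil) a) a (encodeList f xs))
  foldlᵗ-any []       d e = Decides-⇔ inj₁ (λ { (inj₁ q) → q }) e
  foldlᵗ-any {P} {Q} (x ∷ xs) d e =
    Decides-⇔ to from (foldlᵗ-any xs d (Decides-or (d x) e))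
    where
    to : (P x ⊎ Q) ⊎ Any P xs → Q ⊎ Any P (x ∷ xs)
    to (inj₁ (inj₁ p)) = inj₂ (here p)
    to (inj₁ (inj₂ q)) = inj₁ q
    to (inj₂ ps)       = inj₂ (there ps)

    from : Q ⊎ Any P (x ∷ xs) → (P x ⊎ Q) ⊎ Any P xs
    from (inj₁ q)          = inj₁ (inj₂ q)
    from (inj₂ (here p))   = inj₁ (inj₁ p)
    from (inj₂ (there ps)) = inj₂ ps

foldlᵗ-Any : ∀ {A : Set} (f : A → Tree) {P : A → Set} {g : Tree → Tree} xs →
  (∀ x → Decides (P x) (g (f x))) →
  Decides (Any P xs) (foldlᵗ (λ h a → condᵗ (g h) (nil ∙ nil) a) nil (encodeList f xs))
foldlᵗ-Any f {P} xs d = Decides-⇔ to inj₂ (foldlᵗ-any f xs d (no λ ()))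
  where
  to : ⊥ ⊎ Any P xs → Any P xs
  to (inj₂ p) = p

data Elems (P : Tree → Set) : Tree → Set where
  nil : Elems P nil
  _∙_ : ∀ {h t} → P h → Elems P t → Elems P (h ∙ t)

-- Equality tests and the predecessor

data Digit : Tree → Set where
  off : Digit nil
  on  : Digit (nil ∙ nil)

eqDigit : Term 2
eqDigit = cond v0 (cond v1 truth leaf) (cond v1 leaf truth)

-- The accumulator is the rest of the second list, wrapped in a pair, or
-- nil after a mismatch.
eqList : Term 2 → Term 2
eqList eq = bind (fold short v0 (pair v1 leaf) match) (cond v0 (cond (fst v0) leaf truth) leaf)
  where
  match : Term 4
  match = cond v1
    (fst v1 and (call eq (v0 ∷ fst (fst v1) ∷ []) and pair (snd (fst v1)) leaf)) leaf

eqNum eqNums eqConf eqNode : Term 2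
eqNum  = eqList eqDigit
eqNums = eqList eqNum
eqConf = call eqNum (fst v0 ∷ fst v1 ∷ []) and call eqNums (snd v0 ∷ snd v1 ∷ [])
eqNode = call eqNum (fst v0 ∷ fst v1 ∷ []) and call eqConf (snd v0 ∷ snd v1 ∷ [])

-- In bijective binary the predecessor of 2(1 + b) is 1 + 2b, a change of one digit, whereas that of
-- 1 + 2b is 2b, which is 2(1 + (b - 1)) unless b is zero. The fold therefore starts at the highest
-- digit and carries the digits read so far together with their predecessor.
decrement : Term 1
decrement = snd (foldr short v0 truth
  (pair (pair v0 (fst v1))
        (cond v0 (cond (fst v1) (pair leaf (snd v1)) leaf) (pair truth (fst v1)))))

module EqList (e : Tree → Tree → Tree) where

  match : Tree → Tree → Tree
  match h a = condᵗ a
    (condᵗ (hdᵗ a) (condᵗ (e h (hdᵗ (hdᵗ a))) (tlᵗ (hdᵗ a) ∙ nil) nil) nil) nil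

  verdict : Tree → Tree
  verdict a = condᵗ a (condᵗ (hdᵗ a) nil (nil ∙ nil)) nil

  foldlᵗ-mismatch : ∀ s → foldlᵗ match nil s ≡ nil
  foldlᵗ-mismatch nil     = refl
  foldlᵗ-mismatch (_ ∙ s) = foldlᵗ-mismatch s

  module _ {P : Tree → Set} (decides : ∀ {s t} → P s → P t → Decides (s ≡ t) (e s t)) where

    verdict-decides : ∀ {s t} → Elems P s → Elems P t →
                      Decides (s ≡ t) (verdict (foldlᵗ match (t ∙ nil) s))
    verdict-decides nil           nil           = yes refl
    verdict-decides nil           (_ ∙ _)       = no λ ()
    verdict-decides {h ∙ s} (p ∙ ps) nil
      rewrite foldlᵗ-mismatch s = no λ ()
    verdict-decides {h ∙ s} {h′ ∙ t} (p ∙ ps) (q ∙ qs) with e h h′ | decides p q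
    ... | _ | yes refl = Decides-⇔ (cong (h ∙_)) (λ { refl → refl }) (verdict-decides ps qs)
    ... | _ | no h≢h′ rewrite foldlᵗ-mismatch s = no λ { refl → h≢h′ refl }

module Equality (K : Clock → Tree) where
  open Semantics K

  -- The length bound guarantees that a fold on the short clock reaches the end of the list.
  Fits : (Tree → Set) → Tree → Set
  Fits P t = Elems P t × len t ≤ len (K short)

  Num Nums : Tree → Set
  Num  = Fits Digit
  Nums = Fits Num

  eqDigit-decides : ∀ {s t} → Digit s → Digit t → Decides (s ≡ t) (⟦ eqDigit ⟧ (s ∷ t ∷ []))
  eqDigit-decides off off = yes refl
  eqDigit-decides off on  = no λ ()
  eqDigit-decides on  off = no λ ()
  eqDigit-decides on  on  = yes refl

  eqList-decides : ∀ {P : Tree → Set} eq →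
    (∀ {s t} → P s → P t → Decides (s ≡ t) (⟦ eq ⟧ (s ∷ t ∷ []))) →
    ∀ {s t} → Fits P s → Fits P t → Decides (s ≡ t) (⟦ eqList eq ⟧ (s ∷ t ∷ []))
  eqList-decides eq d {s} {t} (ps , s≤) (pt , _) =
    subst (λ v → Decides (s ≡ t) (verdict v)) (sym (foldᵗ≡foldlᵗ (K short) s s≤))
      (verdict-decides d ps pt)
    where open EqList (λ s t → ⟦ eq ⟧ (s ∷ t ∷ []))

  eqNum-decides : ∀ {s t} → Num s → Num t → Decides (s ≡ t) (⟦ eqNum ⟧ (s ∷ t ∷ []))
  eqNum-decides = eqList-decides eqDigit eqDigit-decides

  eqNums-decides : ∀ {s t} → Nums s → Nums t → Decides (s ≡ t) (⟦ eqNums ⟧ (s ∷ t ∷ []))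
  eqNums-decides = eqList-decides eqNum eqNum-decides

  data Conf : Tree → Set where
    _∙_ : ∀ {a pc} → Num a → Nums pc → Conf (a ∙ pc)

  eqConf-decides : ∀ {s t} → Conf s → Conf t → Decides (s ≡ t) (⟦ eqConf ⟧ (s ∷ t ∷ []))
  eqConf-decides (a ∙ pc) (a′ ∙ pc′) =
    Decides-⇔ (λ { (refl , refl) → refl }) (λ { refl → refl , refl })
      (Decides-and (eqNum-decides a a′) (eqNums-decides pc pc′))

  decrement≡ : ∀ n → len (encodeℕ (suc n)) ≤ len (K short) →
               ⟦ decrement ⟧ (encodeℕ (suc n) ∷ []) ≡ encodeℕ n
  decrement≡ n n≤ = trans
    (cong tlᵗ (trans (foldᵗ≡foldrᵗ (K short) (encodeℕ (suc n)) n≤) (both (fromℕ (suc n)))))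
    (cong encodeℕᵇ pred-fromℕ)
    where
    digit : Tree → Tree → Tree
    digit h a = (h ∙ hdᵗ a) ∙ condᵗ h (condᵗ (hdᵗ a) (nil ∙ tlᵗ a) nil) ((nil ∙ nil) ∙ hdᵗ a)

    both : ∀ b → foldrᵗ digit (nil ∙ nil) (encodeℕᵇ b) ≡ encodeℕᵇ b ∙ encodeℕᵇ (pred b)
    both zero = refl
    both 2[1+ b ] rewrite both b = refl
    both 1+[2 b ] = trans (cong (digit (nil ∙ nil)) (both b)) (doubled b)
      where
      doubled : ∀ b → digit (nil ∙ nil) (encodeℕᵇ b ∙ encodeℕᵇ (pred b)) ≡
                      encodeℕᵇ 1+[2 b ] ∙ encodeℕᵇ (pred 1+[2 b ])
      doubled zero     = refl
      doubled 2[1+ b ] = refl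
      doubled 1+[2 b ] = refl

    pred-fromℕ : pred (fromℕ (suc n)) ≡ fromℕ n
    pred-fromℕ = sym (Binary.fromℕ-pred (suc n))

-- Deciding steps between nodes

-- With flags instead of a binary index, a fold over the threads can read off in parallel whether
-- each one is the writer, and the list of all writers is obtained from the threads without
-- arithmetic.
oneHot : ∀ {n} → Fin n → Tree
oneHot zero    = (nil ∙ nil) ∙ nil
oneHot (suc i) = nil ∙ oneHot i

-- The arguments are a transition, the states before and after, the memory values before and after,
-- and the flag of the writer.
transition : Term 6
transition = call eqNum (fst v0 ∷ v1 ∷ []) and call eqNum (snd (snd v0) ∷ v2 ∷ []) and
  cond label
    (cond (fst label)
      (v5 and call eqNum (snd label ∷ v4 ∷ []))
      (call eqNum (snd label ∷ v3 ∷ []) and call eqNum (v3 ∷ v4 ∷ [])))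
    (call eqNum (v3 ∷ v4 ∷ []))
  where
  label : Term 6
  label = fst (snd v0)

anyTransition : Term 6
anyTransition = fold short v0 leaf
  (cond (call transition (v0 ∷ v3 ∷ v4 ∷ v5 ∷ v6 ∷ v7 ∷ [])) truth v1)

-- The accumulator consists of: whether the states of the threads seen so
-- far agree; whether a step of one of them leads from pc to pc′; the
-- rests of pc, pc′ and the writer.
threadStepBody : Term 8
threadStepBody = pair (agree and call eqNum (fst pc ∷ fst pc′ ∷ []))
  (pair (cond found truth
          (agree and call anyTransition (snd (snd v0) ∷ fst pc ∷ fst pc′ ∷ v5 ∷ v6 ∷ fst w ∷ [])
                 and call eqNums (snd pc ∷ snd pc′ ∷ [])))
    (pair (snd pc) (pair (snd pc′) (snd w))))
  where
  agree found pc pc′ w : Term 8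
  agree = fst v1
  found = fst (snd v1)
  pc    = fst (snd (snd v1))
  pc′   = fst (snd (snd (snd v1)))
  w     = snd (snd (snd (snd v1)))

threadStep : Term 6
threadStep = fst (snd (fold short v0
  (pair truth (pair leaf (pair v1 (pair v2 v5)))) threadStepBody))

succNode : Term 3
succNode = call eqNum (fst v1 ∷ fst v2 ∷ []) and
  call threadStep (v0 ∷ snd (snd v1) ∷ snd (snd v2) ∷ fst (snd v1) ∷ fst (snd v2) ∷ fst v1 ∷ [])

encodeℕᵇ-digits : ∀ b → Elems Digit (encodeℕᵇ b)
encodeℕᵇ-digits zero     = nil
encodeℕᵇ-digits 2[1+ b ] = off ∙ encodeℕᵇ-digits b
encodeℕᵇ-digits 1+[2 b ] = on ∙ encodeℕᵇ-digits b

encodeℕᵇ-injective : ∀ b c → encodeℕᵇ b ≡ encodeℕᵇ c → b ≡ c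
encodeℕᵇ-injective zero     zero     e = refl
encodeℕᵇ-injective 2[1+ b ] 2[1+ c ] e = cong 2[1+_] (encodeℕᵇ-injective b c (cong tlᵗ e))
encodeℕᵇ-injective 1+[2 b ] 1+[2 c ] e = cong 1+[2_] (encodeℕᵇ-injective b c (cong tlᵗ e))
encodeℕᵇ-injective zero     2[1+ c ] ()
encodeℕᵇ-injective zero     1+[2 c ] ()
encodeℕᵇ-injective 2[1+ b ] zero     ()
encodeℕᵇ-injective 2[1+ b ] 1+[2 c ] ()
encodeℕᵇ-injective 1+[2 b ] zero     ()
encodeℕᵇ-injective 1+[2 b ] 2[1+ c ] ()

encodeFin-injective : ∀ {n} (i j : Fin n) → encodeFin i ≡ encodeFin j → i ≡ j
encodeFin-injective i j e =
  Fin.toℕ-injective (Binary.fromℕ-injective (encodeℕᵇ-injective (fromℕ (toℕ i)) (fromℕ (toℕ j)) e))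

encodePC-injective : ∀ {d t} {Ps : Vec (Thread d) t} (pc pc′ : PC Ps) →
                     encodePC pc ≡ encodePC pc′ → pc ≡ pc′
encodePC-injective []       []         e = refl
encodePC-injective (q ∷ pc) (q′ ∷ pc′) e =
  cong₂ _∷_ (encodeFin-injective q q′ (cong hdᵗ e)) (encodePC-injective pc pc′ (cong tlᵗ e))

oneHot-injective : ∀ {n} {i j : Fin n} → oneHot i ≡ oneHot j → i ≡ j
oneHot-injective {i = zero}  {zero}  e = refl
oneHot-injective {i = suc i} {suc j} e = cong suc (oneHot-injective (cong tlᵗ e))

oneHot-digits : ∀ {n} (i : Fin n) → Elems Digit (oneHot i)
oneHot-digits zero    = on ∙ nil
oneHot-digits (suc i) = off ∙ oneHot-digits i

len-oneHot : ∀ {n} (i : Fin n) → len (oneHot i) ≤ n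
len-oneHot zero    = s≤s z≤n
len-oneHot (suc i) = s≤s (len-oneHot i)

record ThreadFits (N : ℕ) {d : ℕ} (P : Thread d) : Set where
  open Thread P using (states; δ)
  field
    state-fits  : (q : Fin states) → len (encodeFin q) ≤ N
    states-fit  : states ≤ N
    δ-fits      : length δ ≤ N

record ProgramFits (N : ℕ) (A : Program) : Set where
  open Program A
  field
    value-fits   : (a : Fin d) → len (encodeFin a) ≤ N
    domain-fits  : d ≤ N
    number-fits  : t ≤ N
    threads-fit  : All (ThreadFits N) threads

Allowed : ∀ {d} → Set → Label d → Set
Allowed W (just (wr _)) = W
Allowed W (just (rd _)) = ⊤
Allowed W nothing       = ⊤

module Successors (K : Clock → Tree) where
  open Semantics K
  open Equality K

  N : ℕ
  N = len (K short)

  Fin-num : ∀ {n} (i : Fin n) → len (encodeFin i) ≤ N → Num (encodeFin i)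
  Fin-num i i≤ = encodeℕᵇ-digits _ , i≤

  Fin-decides : ∀ {n} (i j : Fin n) → len (encodeFin i) ≤ N → len (encodeFin j) ≤ N →
                Decides (i ≡ j) (⟦ eqNum ⟧ (encodeFin i ∷ encodeFin j ∷ []))
  Fin-decides i j i≤ j≤ =
    Decides-⇔ (encodeFin-injective i j) (cong encodeFin) (eqNum-decides (Fin-num i i≤) (Fin-num j j≤))

  oneHot-num : ∀ {n} → n ≤ N → (i : Fin n) → Num (oneHot i)
  oneHot-num n≤ i = oneHot-digits i , ≤-trans (len-oneHot i) n≤

  PC-nums : ∀ {d t} {Ps : Vec (Thread d) t} → All (ThreadFits N) Ps → t ≤ N → (pc : PC Ps) →
            Nums (encodePC pc)
  PC-nums fits t≤ pc = elems fits pc , ≤-trans (≤-reflexive (width pc)) t≤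
    where
    elems : ∀ {d t} {Ps : Vec (Thread d) t} → All (ThreadFits N) Ps → (pc : PC Ps) →
            Elems Num (encodePC pc)
    elems []       []       = nil
    elems (f ∷ fs) (q ∷ pc) = Fin-num q (ThreadFits.state-fits f q) ∙ elems fs pc

    width : ∀ {d t} {Ps : Vec (Thread d) t} (pc : PC Ps) → len (encodePC pc) ≡ t
    width []       = refl
    width (q ∷ pc) = cong suc (width pc)

  module _ {d : ℕ} (value-fits : (a : Fin d) → len (encodeFin a) ≤ N) (a a′ : Fin d) where

    module _ {P : Thread d} (fits : ThreadFits N P) (q q′ : State P)
             {W : Set} {w : Tree} (w-decides : Decides W w) where
      open ThreadFits fits

      Matches : State P × Label d × State P → Set
      Matches (p , o , p′) = p ≡ q × p′ ≡ q′ × MemStep a o a′ × Allowed W o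

      encodeTransition : State P × Label d × State P → Tree
      encodeTransition (p , o , p′) = encodeFin p ∙ encodeLabel o ∙ encodeFin p′

      transition-decides : ∀ τ → Decides (Matches τ)
        (⟦ transition ⟧ (encodeTransition τ ∷ encodeFin q ∷ encodeFin q′ ∷
                         encodeFin a ∷ encodeFin a′ ∷ w ∷ []))
      transition-decides (p , o , p′) =
        Decides-and (Fin-decides p q (state-fits p) (state-fits q))
          (Decides-and (Fin-decides p′ q′ (state-fits p′) (state-fits q′)) (label o))
        where
        memory : Fin d → Fin d → Tree
        memory b c = ⟦ eqNum ⟧ (encodeFin b ∷ encodeFin c ∷ [])

        memory-decides : ∀ b c → Decides (b ≡ c) (memory b c)
        memory-decides b c = Fin-decides b c (value-fits b) (value-fits c)

        label : ∀ o → Decides (MemStep a o a′ × Allowed W o)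
          (let l = encodeLabel o in
           condᵗ l (condᵗ (hdᵗ l)
             (condᵗ w (⟦ eqNum ⟧ (tlᵗ l ∷ encodeFin a′ ∷ [])) nil)
             (condᵗ (⟦ eqNum ⟧ (tlᵗ l ∷ encodeFin a ∷ [])) (memory a a′) nil))
             (memory a a′))
        label nothing = Decides-⇔ (λ { refl → skip , tt }) (λ { (skip , _) → refl })
          (memory-decides a a′)
        label (just (rd b)) = Decides-⇔ (λ { (refl , refl) → read , tt }) (λ { (read , _) → refl , refl })
          (Decides-and (memory-decides b a) (memory-decides a a′))
        label (just (wr b)) = Decides-⇔ (λ { (v , refl) → write , v }) (λ { (write , v) → v , refl })
          (Decides-and w-decides (memory-decides b a′))

      anyTransition-decides :
        Decides (∃[ o ] ((q , o , q′) ∈ Thread.δ P × MemStep a o a′ × Allowed W o))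
          (⟦ anyTransition ⟧ (encodeList encodeTransition (Thread.δ P) ∷ encodeFin q ∷ encodeFin q′ ∷
                              encodeFin a ∷ encodeFin a′ ∷ w ∷ []))
      anyTransition-decides =
        subst (Decides _)
          (sym (foldᵗ≡foldlᵗ (K short) (encodeList encodeTransition (Thread.δ P))
             (≤-trans (≤-reflexive (len-encodeList encodeTransition (Thread.δ P))) δ-fits)))
          (Decides-⇔ to from (foldlᵗ-Any encodeTransition (Thread.δ P) transition-decides))
        where
        to : Any Matches (Thread.δ P) → _
        to m with find m
        ... | (_ , o , _) , o∈ , refl , refl , m , w = o , o∈ , m , w

        from : _ → Any Matches (Thread.δ P)
        from (_ , o∈ , m , w) = lose o∈ (refl , refl , m , w)

    Flags : ∀ n → Tree → (Fin n → Set) → Set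
    Flags zero    w W = ⊤
    Flags (suc n) w W = Decides (W zero) (hdᵗ w) × Flags n (tlᵗ w) (W ∘ suc)

    Flags-oneHot : ∀ {n} (i : Fin n) → Flags n (oneHot i) (λ j → j ≡ i)
    -- The list ends after its one; the missing flags read as false because the head of `nil` is
    -- `nil`.
    Flags-oneHot {suc n} zero = yes refl , none n (λ ())
      where
      none : ∀ n {W : Fin n → Set} → (∀ {j} → ¬ W j) → Flags n nil W
      none zero    ¬w = tt
      none (suc n) ¬w = no ¬w , none n ¬w
    Flags-oneHot {suc n} (suc i) = no (λ ()) , map n (cong suc) Fin.suc-injective (Flags-oneHot i)
      where
      map : ∀ n {w} {V W : Fin n → Set} → (∀ {j} → V j → W j) → (∀ {j} → W j → V j) →
            Flags n w V → Flags n w W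
      map zero    f g _        = tt
      map (suc n) f g (v , vs) = Decides-⇔ f g v , map n f g vs

    LocalStep : ∀ {t} {Ps : Vec (Thread d) t} → (Fin t → Set) → PC Ps → PC Ps → Set
    LocalStep W pc pc′ = ∃[ i ] ∃[ o ] (ThreadStep o i pc pc′ × MemStep a o a′ × Allowed (W i) o)

    module _ (ts ps ps′ ws : Tree) where

      body : Tree → Tree → Tree
      body h s = ⟦ threadStepBody ⟧ (h ∷ s ∷ ts ∷ ps ∷ ps′ ∷ encodeFin a ∷ encodeFin a′ ∷ ws ∷ [])

      -- `O` and `F` are what the accumulator decides about the threads already passed: that all
      -- keep their states, and that a step has been found. A step of the first thread needs the
      -- rest to agree; a step of a later one needs the first to agree, which goes into `O`.
      foldlᵗ-threads : ∀ {t} {Ps : Vec (Thread d) t} → All (ThreadFits N) Ps → t ≤ N →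
        ∀ (pc pc′ : PC Ps) {w W O F o f} → Flags t w W → Decides O o → Decides F f →
        Decides (F ⊎ (O × LocalStep W pc pc′))
          (hdᵗ (tlᵗ (foldlᵗ body (o ∙ f ∙ encodePC pc ∙ encodePC pc′ ∙ w)
                                 (encodeList encodeThread (Vec.toList Ps)))))
      foldlᵗ-threads [] _ [] [] _ _ f = Decides-⇔ inj₁ (λ { (inj₁ x) → x ; (inj₂ (_ , () , _)) }) f
      foldlᵗ-threads {suc t} {P ∷ Ps} (fit ∷ fits) t≤ (q ∷ pc) (q′ ∷ pc′) {w} {W} {O} {F}
                     (flag , flags) o f =
        Decides-⇔ to from (foldlᵗ-threads fits t≤′ pc pc′ flags
          (Decides-and o (Fin-decides q q′ (state-fits q) (state-fits q′)))
          (Decides-or f (Decides-and o (Decides-and (anyTransition-decides fit q q′ flag)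
            (Decides-⇔ (encodePC-injective pc pc′) (cong encodePC)
              (eqNums-decides (PC-nums fits t≤′ pc) (PC-nums fits t≤′ pc′)))))))
        where
        open ThreadFits fit
        t≤′ = ≤-trans (n≤1+n t) t≤

        Here = ∃[ o ] ((q , o , q′) ∈ Thread.δ P × MemStep a o a′ × Allowed (W zero) o)

        to : (F ⊎ (O × (Here × pc ≡ pc′))) ⊎ ((O × q ≡ q′) × LocalStep (W ∘ suc) pc pc′) →
             F ⊎ (O × LocalStep W (q ∷ pc) (q′ ∷ pc′))
        to (inj₁ (inj₁ x)) = inj₁ x
        to (inj₁ (inj₂ (x , (l , τ∈ , m , v) , refl))) = inj₂ (x , zero , l , here τ∈ , m , v)
        to (inj₂ ((x , refl) , i , l , s , m , v))     = inj₂ (x , suc i , l , there s , m , v)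

        from : F ⊎ (O × LocalStep W (q ∷ pc) (q′ ∷ pc′)) →
               (F ⊎ (O × (Here × pc ≡ pc′))) ⊎ ((O × q ≡ q′) × LocalStep (W ∘ suc) pc pc′)
        from (inj₁ x) = inj₁ (inj₁ x)
        from (inj₂ (x , zero , l , here τ∈ , m , v))   = inj₁ (inj₂ (x , (l , τ∈ , m , v) , refl))
        from (inj₂ (x , suc i , l , there s , m , v))  = inj₂ ((x , refl) , i , l , s , m , v)

  len-threads : ∀ {d t} (Ps : Vec (Thread d) t) →
                len (encodeList encodeThread (Vec.toList Ps)) ≡ t
  len-threads []       = refl
  len-threads (P ∷ Ps) = cong suc (len-threads Ps)

  module _ (A : Program) (fits : ProgramFits N A) where
    open Program A
    open ProgramFits fits

    threadsTree : Tree
    threadsTree = encodeList encodeThread (Vec.toList threads)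

    encodeNode : Node A → Tree
    encodeNode (i , a , pc) = oneHot i ∙ encodeFin a ∙ encodePC pc

    encodeNode-injective : ∀ x y → encodeNode x ≡ encodeNode y → x ≡ y
    encodeNode-injective (i , a , pc) (j , b , pc′) e =
      cong₂ _,_ (oneHot-injective (cong hdᵗ e))
        (cong₂ _,_ (encodeFin-injective a b (cong (hdᵗ ∘ tlᵗ) e))
                     (encodePC-injective pc pc′ (cong (tlᵗ ∘ tlᵗ) e)))

    node-conf : ∀ x → Conf (tlᵗ (encodeNode x))
    node-conf (i , a , pc) = Fin-num a (value-fits a) ∙ PC-nums threads-fit number-fits pc

    eqNode-decides : ∀ x y → Decides (x ≡ y) (⟦ eqNode ⟧ (encodeNode x ∷ encodeNode y ∷ []))
    eqNode-decides x y =
      Decides-⇔ (λ (e , e′) → encodeNode-injective x y (cong₂ _∙_ e e′)) (λ { refl → refl , refl })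
        (Decides-and (eqNum-decides (oneHot-num number-fits (proj₁ x)) (oneHot-num number-fits (proj₁ y)))
                     (eqConf-decides (node-conf x) (node-conf y)))

    conf-injective : ∀ x y → tlᵗ (encodeNode x) ≡ tlᵗ (encodeNode y) → config A x ≡ config A y
    conf-injective (_ , a , pc) (_ , b , pc′) e =
      cong₂ _,_ (encodePC-injective pc pc′ (cong tlᵗ e)) (encodeFin-injective a b (cong hdᵗ e))

    same-decides : ∀ x y → Decides (Same A x y)
                   (⟦ eqConf ⟧ (tlᵗ (encodeNode x) ∷ tlᵗ (encodeNode y) ∷ []))
    same-decides x y = Decides-⇔ (conf-injective x y) (cong λ (pc , a) → encodeFin a ∙ encodePC pc)
      (eqConf-decides (node-conf x) (node-conf y))

    succ-decides : ∀ x y → Decides (Succ A x y)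
                   (⟦ succNode ⟧ (threadsTree ∷ encodeNode x ∷ encodeNode y ∷ []))
    succ-decides (i , a , pc) (i′ , a′ , pc′) =
      Decides-and
        (Decides-⇔ oneHot-injective (cong oneHot)
          (eqNum-decides (oneHot-num number-fits i) (oneHot-num number-fits i′)))
        (Decides-⇔ to from
          (subst (λ v → Decides (⊥ ⊎ (⊤ × Local)) (hdᵗ (tlᵗ v)))
            (sym (foldᵗ≡foldlᵗ (K short) threadsTree
              (≤-trans (≤-reflexive (len-threads threads)) number-fits)))
            (foldlᵗ-threads value-fits a a′ threadsTree (encodePC pc) (encodePC pc′) (oneHot i)
              threads-fit number-fits pc pc′
              (Flags-oneHot value-fits a a′ i) (yes tt) (no λ ()))))
      where
      Step′ : Set
      Step′ = Σ[ st ∈ Step A (pc , a) (pc′ , a′) ] WritesOnlyBy A i st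

      Local : Set
      Local = LocalStep value-fits a a′ (_≡ i) pc pc′

      to : ⊥ ⊎ (⊤ × Local) → Step′
      to (inj₂ (_ , j , just (wr _) , s , m , e)) = step j _ s m , e
      to (inj₂ (_ , j , just (rd _) , s , m , _)) = step j _ s m , tt
      to (inj₂ (_ , j , nothing , s , m , _))     = step j _ s m , tt

      from : Step′ → ⊥ ⊎ (⊤ × Local)
      from (step j (just (wr _)) s m , e) = inj₂ (tt , j , _ , s , m , e)
      from (step j (just (rd _)) s m , _) = inj₂ (tt , j , _ , s , m , tt)
      from (step j nothing s m , _)       = inj₂ (tt , j , _ , s , m , tt)

-- The table of marks and the rounds of the search

-- The only test is that for nil: a done mark is recognised by its head, a current one by its tail,
-- and a seen one by not being nil.
nextMark currentMark doneMark : ∀ {n} → Term n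
nextMark    = truth
currentMark = pair leaf truth
doneMark    = pair truth leaf

newMark : Term 4
newMark = cond (call eqNode (v1 ∷ v3 ∷ [])) doneMark
  (cond (fst v2) v2 (cond (snd v2) v2
    (cond (call succNode (v0 ∷ v1 ∷ v3 ∷ [])) currentMark
      (cond v2 v2 (cond (call eqConf (snd v1 ∷ snd v3 ∷ [])) nextMark leaf)))))

relaxTable : Term 3
relaxTable = foldr long v2 leaf
  (pair (pair (call newMark (v2 ∷ v3 ∷ fst v0 ∷ snd v0 ∷ [])) (snd v0)) v1)

findCurrent shiftTable : Term 1
findCurrent = foldr long v0 leaf (cond (snd (fst v0)) v0 v1)
shiftTable  = foldr long v0 leaf
  (pair (pair (cond (fst v0) (cond (fst (fst v0)) (fst v0) currentMark) leaf) (snd v0)) v1)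

round : Term 3
round = bind
  (cond (call findCurrent (v1 ∷ [])) (pair v1 v2)
    (cond v2 (pair (call shiftTable (v1 ∷ [])) (call decrement (v2 ∷ []))) (pair v1 v2)))
  -- The search is repeated, as the shift may have made nodes current.
  (bind (call findCurrent (fst v0 ∷ []))
    (cond v0 (pair (call relaxTable (v2 ∷ snd v0 ∷ fst v1 ∷ [])) (snd v1)) v1))

run : Term 3
-- The entries of the list are ignored; it only provides one round per node.
run = fold long longClock (pair v1 v2) (call round (v2 ∷ fst v1 ∷ snd v1 ∷ []))

initialTable initialStates : Term 1
initialTable  = foldr long longClock leaf
  (pair (pair (cond (call eqConf (snd v0 ∷ v2 ∷ [])) nextMark leaf) v0) v1)
initialStates = foldr short v0 leaf (pair (fst (snd v0)) v1)

member accept : Term 2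
-- The components are swapped: configurations of the input begin with the states, those inside nodes
-- with the memory value.
member = fold short v0 leaf (cond (call eqConf (pair (snd v0) (fst v0) ∷ v3 ∷ [])) truth v1)
accept = fold long v0 leaf (cond (fst v0 and call member (v3 ∷ snd (snd v0) ∷ [])) truth v1)

main : Term 1
main = call accept (fst (call run (threads ∷ table ∷ snd (snd v0) ∷ [])) ∷ fst (snd v0) ∷ [])
  where
  threads table : Term 1
  threads = snd (snd (fst v0))
  table   = call initialTable
    (pair (fst (snd (fst v0))) (call initialStates (threads ∷ [])) ∷ [])

encodeMark : Mark → Tree
encodeMark unseen  = nil
encodeMark next    = nil ∙ nil
encodeMark current = nil ∙ nil ∙ nil
encodeMark done    = (nil ∙ nil) ∙ nil

seen-decides : ∀ m → Decides (Seen m) (encodeMark m)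
seen-decides unseen  = no λ { (active ()) }
seen-decides next    = yes next
seen-decides current = yes (active current)
seen-decides done    = yes (active done)

encodeℕ-suc : ∀ n {u v} → condᵗ (encodeℕ (suc n)) u v ≡ u
encodeℕ-suc n = nonzero (fromℕ (suc n)) λ e →
  0≢1+n (trans (cong Data.Nat.Binary.toℕ (sym e)) (Binary.toℕ-fromℕ (suc n)))
  where
  nonzero : ∀ b → b ≢ zero → ∀ {u v} → condᵗ (encodeℕᵇ b) u v ≡ u
  nonzero zero     b≢0 = ⊥-elim (b≢0 refl)
  nonzero 2[1+ _ ] _   = refl
  nonzero 1+[2 _ ] _   = refl

-- The stage counter has to stay within the short clock for `decrement` to be correct in later
-- rounds.
len-encodeℕ-suc : ∀ n → len (encodeℕ n) ≤ len (encodeℕ (suc n))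
len-encodeℕ-suc n = subst (λ b → len (encodeℕᵇ b) ≤ len (encodeℕ (suc n)))
  (sym (Binary.fromℕ-pred (suc n))) (len-pred (fromℕ (suc n)))
  where
  len-pred : ∀ b → len (encodeℕᵇ (pred b)) ≤ len (encodeℕᵇ b)
  len-pred zero              = ≤-refl
  len-pred 2[1+ b ]          = ≤-refl
  len-pred 1+[2 zero ]       = z≤n
  len-pred 1+[2 2[1+ b ] ]   = ≤-refl
  len-pred 1+[2 1+[2 b ] ]   = s≤s (len-pred 1+[2 b ])

someFin : ∀ n → {{NonZero n}} → Fin n
someFin (suc n) = zero

module Decision (K : Clock → Tree) (I : Instance)
  (fits : ProgramFits (len (K short)) (Instance.program I))
  (Cᶠ-fits : length (Instance.Cᶠ I) ≤ len (K short))
  (s-fits : len (encodeℕ (Instance.s I)) ≤ len (K short)) where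

  open Semantics K
  open Equality K
  open Successors K
  open Instance I renaming (program to A)
  open Program A
  open Search (Succ A) (Same A) (Init A) (λ _ → refl)
  open ProgramFits fits

  module _ (nodes : List (Node A)) (all-nodes : ∀ x → x ∈ nodes)
           (long≡ : K long ≡ encodeList (encodeNode A fits) nodes) where

    node : Node A → Tree
    node = encodeNode A fits

    threadsᵗ : Tree
    threadsᵗ = threadsTree A fits

    entry : Marking → Node A → Tree
    entry μ y = encodeMark (μ y) ∙ node y

    table : Marking → Tree
    table μ = encodeList (entry μ) nodes

    long-fits : ∀ {f : Node A → Tree} → len (encodeList f nodes) ≤ len (K long)
    long-fits {f} = ≤-reflexive (trans (len-encodeList f nodes)
      (sym (trans (cong len long≡) (len-encodeList node nodes))))

    newMark-relaxed : ∀ x y m → ∃[ m′ ]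
      (⟦ newMark ⟧ (threadsᵗ ∷ node x ∷ encodeMark m ∷ node y ∷ []) ≡ encodeMark m′ ×
       Relaxed x y m m′)
    newMark-relaxed x y m =
      choose m (eqNode-decides A fits x y) (succ-decides A fits x y) (same-decides A fits x y)
      where
      choose : ∀ m {e s c} → Decides (x ≡ y) e → Decides (Succ A x y) s → Decides (Same A x y) c →
        ∃[ m′ ] (condᵗ e (encodeMark done)
           (condᵗ (hdᵗ (encodeMark m)) (encodeMark m) (condᵗ (tlᵗ (encodeMark m)) (encodeMark m)
             (condᵗ s (encodeMark current)
               (condᵗ (encodeMark m) (encodeMark m) (condᵗ c (encodeMark next) nil)))))
           ≡ encodeMark m′ × Relaxed x y m m′)
      choose m       (yes e) _       _       = done , refl , hit e
      choose done    (no _)  _       _       = done , refl , keep-done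
      choose current (no ≢)  _       _       = current , refl , keep-current ≢
      choose next    (no ≢)  (yes s) _       = current , refl , reach ≢ (λ ()) s
      choose unseen  (no ≢)  (yes s) _       = current , refl , reach ≢ (λ ()) s
      choose next    (no _)  (no ¬s) _       = next , refl , keep-next ¬s
      choose unseen  (no _)  (no ¬s) (yes c) = next , refl , discover ¬s c
      choose unseen  (no _)  (no ¬s) (no ¬c) = unseen , refl , ignore ¬s ¬c

    relaxTable-relaxed : ∀ x μ → ∃[ μ′ ]
      (⟦ relaxTable ⟧ (threadsᵗ ∷ node x ∷ table μ ∷ []) ≡ table μ′ ×
       (∀ y → Relaxed x y (μ y) (μ′ y)))
    relaxTable-relaxed x μ = (λ y → proj₁ (new y)) ,
      trans (foldᵗ≡foldrᵗ (K long) (table μ) long-fits)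
            (foldrᵗ-map (entry μ) (λ y _ → cong (λ m → (m ∙ node y) ∙ _) (proj₁ (proj₂ (new y)))) nodes) ,
      (λ y → proj₂ (proj₂ (new y)))
      where
      new : ∀ y → _
      new y = newMark-relaxed x y (μ y)

    shiftTable≡ : ∀ μ → ⟦ shiftTable ⟧ (table μ ∷ []) ≡ table (shift ∘ μ)
    shiftTable≡ μ = trans (foldᵗ≡foldrᵗ (K long) (table μ) long-fits)
      (foldrᵗ-map (entry μ) (λ y a → cong (λ m → (m ∙ node y) ∙ a) (shiftMark (μ y))) nodes)
      where
      shiftMark : ∀ m → condᵗ (encodeMark m)
        (condᵗ (hdᵗ (encodeMark m)) (encodeMark m) (encodeMark current)) nil ≡ encodeMark (shift m)
      shiftMark unseen  = refl
      shiftMark next    = refl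
      shiftMark current = refl
      shiftMark done    = refl

    data Found (μ : Marking) (xs : List (Node A)) : Tree → Set where
      none : (∀ {x} → x ∈ xs → μ x ≢ current) → Found μ xs nil
      some : ∀ x {m} → μ x ≡ current → Found μ xs (m ∙ node x)

    findCurrent-found : ∀ μ → Found μ nodes (⟦ findCurrent ⟧ (table μ ∷ []))
    findCurrent-found μ = subst (Found μ nodes) (sym (foldᵗ≡foldrᵗ (K long) (table μ) long-fits)) (go nodes)
      where
      current-decides : ∀ m → Decides (m ≡ current) (tlᵗ (encodeMark m))
      current-decides unseen  = no λ ()
      current-decides next    = no λ ()
      current-decides current = yes refl
      current-decides done    = no λ ()

      pick : ∀ {x xs c t} → Decides (μ x ≡ current) c → Found μ xs t →
             Found μ (x ∷ xs) (condᵗ c (entry μ x) t)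
      pick (yes e) _          = some _ e
      pick (no ¬e) (none h)   = none λ { (here refl) → ¬e ; (there x∈) → h x∈ }
      pick (no ¬e) (some x e) = some x e

      go : ∀ xs → Found μ xs (foldrᵗ (λ h a → condᵗ (tlᵗ (hdᵗ h)) h a) nil (encodeList (entry μ) xs))
      go []       = none λ ()
      go (x ∷ xs) = pick (current-decides (μ x)) (go xs)

    Rounded : Marking → ℕ → Tree → Set
    Rounded μ k t = ∃[ μ′ ] ∃[ k′ ] (t ≡ table μ′ ∙ encodeℕ k′ × Round μ k μ′ k′ ×
                                     len (encodeℕ k′) ≤ len (K short))

    round-rounded : ∀ μ k → len (encodeℕ k) ≤ len (K short) →
                    Rounded μ k (⟦ round ⟧ (threadsᵗ ∷ table μ ∷ encodeℕ k ∷ []))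
    round-rounded μ k k≤ = first k k≤ (findCurrent-found μ)
      where
      search : Tree → Tree
      search t = ⟦ findCurrent ⟧ (t ∷ [])

      relaxed : Tree → Tree → Tree
      relaxed x t = ⟦ relaxTable ⟧ (threadsᵗ ∷ x ∷ t ∷ [])

      explore : Tree → Tree → Tree
      explore f st = condᵗ f (relaxed (tlᵗ f) (hdᵗ st) ∙ tlᵗ st) st

      advance : Tree → Tree
      advance st = explore (search (hdᵗ st)) st

      Advanced : Marking → ℕ → Set
      Advanced μ k =
        (NoCurrent μ × advance (table μ ∙ encodeℕ k) ≡ table μ ∙ encodeℕ k) ⊎
        ∃[ x ] ∃[ μ′ ] (μ x ≡ current × (∀ y → Relaxed x y (μ y) (μ′ y)) ×
                        advance (table μ ∙ encodeℕ k) ≡ table μ′ ∙ encodeℕ k)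

      advanced : ∀ μ k → Advanced μ k
      advanced μ k with search (table μ) | findCurrent-found μ
      ... | _ | none h   = inj₁ ((λ x → h (all-nodes x)) , refl)
      ... | _ | some x e =
        let μ′ , e′ , r = relaxTable-relaxed x μ
        in inj₂ (x , μ′ , e , r , cong (_∙ encodeℕ k) e′)

      first : ∀ k → len (encodeℕ k) ≤ len (K short) → ∀ {f} → Found μ nodes f →
        Rounded μ k (advance (condᵗ f (table μ ∙ encodeℕ k)
          (condᵗ (encodeℕ k) (⟦ shiftTable ⟧ (table μ ∷ []) ∙ ⟦ decrement ⟧ (encodeℕ k ∷ []))
            (table μ ∙ encodeℕ k))))
      first k k≤ (some x e) with advanced μ k
      ... | inj₁ (nc , _)              = ⊥-elim (nc x e)
      ... | inj₂ (_ , μ′ , c , r , e′) = μ′ , k , e′ , relax c r , k≤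
      first zero k≤ (none h) with advanced μ zero
      ... | inj₁ (nc , e)              = μ , zero , e , stop nc , k≤
      ... | inj₂ (x , _ , c , _)       = ⊥-elim (h (all-nodes x) c)
      first (suc k) k≤ (none h)
        rewrite encodeℕ-suc k {⟦ shiftTable ⟧ (table μ ∷ []) ∙ ⟦ decrement ⟧ (encodeℕ (suc k) ∷ [])}
                              {table μ ∙ encodeℕ (suc k)}
              | shiftTable≡ μ | decrement≡ k k≤
        with advanced (shift ∘ μ) k
      ... | inj₁ (nc , e) =
        shift ∘ μ , k , e , shift-only (λ x → h (all-nodes x)) nc , ≤-trans (len-encodeℕ-suc k) k≤
      ... | inj₂ (x , μ′ , c , r , e) =
        μ′ , k , e , shift-relax (λ x → h (all-nodes x)) c r , ≤-trans (len-encodeℕ-suc k) k≤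

    run-final : ∀ {μ k} → Progress nodes all-nodes k (length nodes) μ k →
      len (encodeℕ k) ≤ len (K short) →
      ∃[ μ′ ] ∃[ k′ ] (hdᵗ (⟦ run ⟧ (threadsᵗ ∷ table μ ∷ encodeℕ k ∷ [])) ≡ table μ′ ×
                       Progress nodes all-nodes k 0 μ′ k′)
    run-final {μ} {k} p k≤ =
      let μ′ , k′ , e , p′ = go nodes p k≤ in
      μ′ , k′ , cong hdᵗ (trans (trans (foldᵗ≡foldlᵗ (K long) (K long) ≤-refl)
        (cong (foldlᵗ rounds (table μ ∙ encodeℕ k)) long≡)) e) , p′
      where
      rounds : Tree → Tree → Tree
      rounds _ a = ⟦ round ⟧ (threadsᵗ ∷ hdᵗ a ∷ tlᵗ a ∷ [])

      go : ∀ xs {μ₁ k₁} → Progress nodes all-nodes k (length xs) μ₁ k₁ →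
        len (encodeℕ k₁) ≤ len (K short) →
        ∃[ μ′ ] ∃[ k′ ] (foldlᵗ rounds (table μ₁ ∙ encodeℕ k₁) (encodeList node xs)
                           ≡ table μ′ ∙ encodeℕ k′ ×
                         Progress nodes all-nodes k 0 μ′ k′)
      go []       {μ₁} {k₁} p _ = μ₁ , k₁ , refl , p
      go (x ∷ xs) {μ₁} {k₁} p k₁≤ =
        let μ₂ , k₂ , e , r , k₂≤ = round-rounded μ₁ k₁ k₁≤
            μ′ , k′ , e′ , p′ = go xs (Progress-round nodes all-nodes r p) k₂≤
        in μ′ , k′ , trans (cong (λ a → foldlᵗ rounds a (encodeList node xs)) e) e′ , p′

    initialStates≡ : ⟦ initialStates ⟧ (threadsᵗ ∷ []) ≡ encodePC (initialPC threads)
    initialStates≡ = trans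
      (foldᵗ≡foldrᵗ (K short) threadsᵗ (≤-trans (≤-reflexive (len-threads threads)) number-fits))
      (go threads)
      where
      go : ∀ {d t} (Ps : Vec (Thread d) t) →
           foldrᵗ (λ h a → hdᵗ (tlᵗ h) ∙ a) nil (encodeList encodeThread (Vec.toList Ps))
             ≡ encodePC (initialPC Ps)
      go []       = refl
      go (P ∷ Ps) = cong (_ ∙_) (go Ps)

    initialTable-initial : ∃[ μ ]
      (⟦ initialTable ⟧ ((encodeFin a⁰ ∙ encodePC (initialPC threads)) ∷ []) ≡ table μ ×
       (∀ x → (Init A x × μ x ≡ next) ⊎ (¬ Init A x × μ x ≡ unseen)))
    initialTable-initial = (λ y → proj₁ (mark y)) ,
      trans (trans (foldᵗ≡foldrᵗ (K long) (K long) ≤-refl) (cong (foldrᵗ _ nil) long≡))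
            (foldrᵗ-map node (λ y a → cong (λ m → (m ∙ node y) ∙ a) (proj₁ (proj₂ (mark y)))) nodes) ,
      (λ y → proj₂ (proj₂ (mark y)))
      where
      start-conf : Tree
      start-conf = encodeFin a⁰ ∙ encodePC (initialPC threads)

      mark : ∀ y → ∃[ m ]
        (condᵗ (⟦ eqConf ⟧ (tlᵗ (node y) ∷ start-conf ∷ [])) (nil ∙ nil) nil ≡ encodeMark m ×
         ((Init A y × m ≡ next) ⊎ (¬ Init A y × m ≡ unseen)))
      -- Any writer will do, since `Same` ignores it; one exists because there is at least one
      -- thread.
      mark y = decide (same-decides A fits y (someFin t , a⁰ , initialPC threads))
        where
        decide : ∀ {c} → Decides (Init A y) c → ∃[ m ] (condᵗ c (nil ∙ nil) nil ≡ encodeMark m ×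
          ((Init A y × m ≡ next) ⊎ (¬ Init A y × m ≡ unseen)))
        decide (yes i) = next , refl , inj₁ (i , refl)
        decide (no ¬i) = unseen , refl , inj₂ (¬i , refl)

    Cᶠᵗ : Tree
    Cᶠᵗ = encodeList (encodeConfig {A}) Cᶠ

    member-decides : ∀ x → Decides (config A x ∈ Cᶠ) (⟦ member ⟧ (Cᶠᵗ ∷ tlᵗ (node x) ∷ []))
    member-decides x = subst (Decides (config A x ∈ Cᶠ))
      (sym (foldᵗ≡foldlᵗ (K short) Cᶠᵗ
        (≤-trans (≤-reflexive (len-encodeList (encodeConfig {A}) Cᶠ)) Cᶠ-fits)))
      (foldlᵗ-Any (encodeConfig {A}) Cᶠ same)
      where
      same : ∀ c → Decides (config A x ≡ c)
        (⟦ eqConf ⟧ ((tlᵗ (encodeConfig {A} c) ∙ hdᵗ (encodeConfig {A} c)) ∷ tlᵗ (node x) ∷ []))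
      same (pc , a) = Decides-⇔ sym sym (same-decides A fits (someFin t , a , pc) x)

    accept-decides : ∀ μ → Decides (Any (λ x → Seen (μ x) × config A x ∈ Cᶠ) nodes)
                                   (⟦ accept ⟧ (table μ ∷ Cᶠᵗ ∷ []))
    accept-decides μ = subst (Decides _) (sym (foldᵗ≡foldlᵗ (K long) (table μ) long-fits))
      (foldlᵗ-Any (entry μ) nodes
        (λ x → Decides-and (seen-decides (μ x)) (member-decides x)))

    main-decides : Decides (Reachable I) (⟦ main ⟧ (encodeInstance I ∷ []))
    main-decides =
      let μ , e , initial    = initialTable-initial
          μ′ , k′ , e′ , fin = run-final (Progress-initial nodes all-nodes s initial) s-fits
      in subst (λ T → Decides (Reachable I) (⟦ accept ⟧ (T ∷ Cᶠᵗ ∷ [])))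
           (sym (trans (cong (λ p → final (⟦ initialTable ⟧ ((encodeFin a⁰ ∙ p) ∷ []))) initialStates≡)
                       (trans (cong final e) e′)))
           (decide μ′ (Progress-final nodes all-nodes fin))
      where
      final : Tree → Tree
      final T = hdᵗ (⟦ run ⟧ (threadsᵗ ∷ T ∷ encodeℕ s ∷ []))

      decide : ∀ μ′ → (∀ x → Seen (μ′ x) ⇔ Available s x) →
               Decides (Reachable I) (⟦ accept ⟧ (table μ′ ∷ Cᶠᵗ ∷ []))
      decide μ′ correct = Decides-⇔ to from (accept-decides μ′)
        where
        to : Any (λ x → Seen (μ′ x) × config A x ∈ Cᶠ) nodes → Reachable I
        to p with find p
        ... | x , _ , seen , c∈ =
          config A x , c∈ , Available⇒Staged A (Equivalence.to (correct x) seen)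

        from : Reachable I → Any (λ x → Seen (μ′ x) × config A x ∈ Cᶠ) nodes
        from ((pc , a) , c∈ , st) = lose (all-nodes x)
          (Equivalence.from (correct x) (Staged⇒Available A st (someFin t)) , c∈)
          where
          x : Node A
          x = someFin t , a , pc

-- The list of all nodes as the long clock

-- `writers` prefixes `nil` to the vectors for the later threads and adds a new first one. A
-- crossing puts the new component in front, so `sets` reverses the state sets and places values and
-- writers behind them: the result has the layout of a node, writer before value before states.
writers sets cross : Term 1
writers = foldr short v0 leaf
  (pair (pair truth leaf) (foldr short v1 leaf (pair (pair leaf v0) v1)))
sets    = fold short threads (pair (fst (fst v0)) (pair (call writers (threads ∷ [])) leaf))
               (pair (fst v0) v1)
  where
  threads : Term 1
  threads = snd (snd (fst v0))
cross   = foldr short v0 leaf (foldr long longClock v1 (pair (pair v2 v0) v1))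

length-cartesianProduct : ∀ {A B : Set} (xs : List A) (ys : List B) →
                          length (cartesianProduct xs ys) ≡ length xs * length ys
length-cartesianProduct []       ys = refl
length-cartesianProduct (x ∷ xs) ys =
  trans (length-++ (List.map (x ,_) ys))
        (cong₂ _+_ (length-map (x ,_) ys) (length-cartesianProduct xs ys))

encodeList-map : ∀ {A B : Set} (f : B → Tree) (g : A → B) xs →
                 encodeList f (List.map g xs) ≡ encodeList (f ∘ g) xs
encodeList-map f g []       = refl
encodeList-map f g (x ∷ xs) = cong (_ ∙_) (encodeList-map f g xs)

-- The order is the one in which the crossings produce the tuples, so that the clock equals the
-- encoding of this list exactly.
pcs : ∀ {d t} (Ps : Vec (Thread d) t) → List (PC Ps)
pcs []       = [] ∷ []
pcs (P ∷ Ps) = List.map (λ (q , pc) → q ∷ pc) (cartesianProduct (allFin (Thread.states P)) (pcs Ps))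

length-allFin : ∀ n → length (allFin n) ≡ n
length-allFin n = length-tabulate (λ i → i)

length-pcs : ∀ {d t} (P : Thread d) (Ps : Vec (Thread d) t) →
             length (pcs (P ∷ Ps)) ≡ Thread.states P * length (pcs Ps)
length-pcs P Ps = trans (length-map _ (cartesianProduct (allFin states) (pcs Ps)))
  (trans (length-cartesianProduct (allFin states) (pcs Ps))
         (cong (_* length (pcs Ps)) (length-allFin states)))
  where open Thread P using (states)

all-pcs : ∀ {d t} {Ps : Vec (Thread d) t} (pc : PC Ps) → pc ∈ pcs Ps
all-pcs []       = here refl
all-pcs (q ∷ pc) = ∈-map⁺ _ (∈-cartesianProduct⁺ (∈-allFin q) (all-pcs pc))

states≥1 : ∀ {d} (P : Thread d) → 1 ≤ Thread.states P
states≥1 P = ≤-trans (s≤s z≤n) (Fin.toℕ<n (Thread.initial P))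

pcs≥1 : ∀ {d t} (Ps : Vec (Thread d) t) → 1 ≤ length (pcs Ps)
pcs≥1 []       = ≤-refl
pcs≥1 (P ∷ Ps) = ≤-trans (*-mono-≤ (states≥1 P) (pcs≥1 Ps)) (≤-reflexive (sym (length-pcs P Ps)))

pcs≤ : ∀ {d t} (Ps : Vec (Thread d) t) →
       length (pcs Ps) ≤ Vec.foldr′ _⊔_ 0 (Vec.map Thread.states Ps) ^ t
pcs≤ []                 = ≤-refl
pcs≤ {t = suc t} (P ∷ Ps) = ≤-trans (≤-reflexive (length-pcs P Ps))
  (*-mono-≤ (m≤m⊔n states m) (≤-trans (pcs≤ Ps) (^-monoˡ-≤ t (m≤n⊔m states m))))
  where
  open Thread P using (states)
  m = Vec.foldr′ _⊔_ 0 (Vec.map Thread.states Ps)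

module Crossing (K : Clock → Tree) where
  open Semantics K

  cross≡ : ∀ {A B : Set} (f : A → Tree) (g : B → Tree) xs ys →
    length xs ≤ len (K short) → K long ≡ encodeList g ys →
    ⟦ cross ⟧ (encodeList f xs ∷ []) ≡
    encodeList (λ (x , y) → f x ∙ g y) (cartesianProduct xs ys)
  cross≡ {A} {B} f g xs ys xs≤ long≡ =
    trans (foldᵗ≡foldrᵗ (K short) (encodeList f xs) (≤-trans (≤-reflexive (len-encodeList f xs)) xs≤))
          (rows xs)
    where
    h : A × B → Tree
    h (x , y) = f x ∙ g y

    row : ∀ x zs ys → foldrᵗ (λ y a → (f x ∙ y) ∙ a) (encodeList h zs) (encodeList g ys) ≡
                      encodeList h (List.map (x ,_) ys ++ zs)
    row x zs []       = refl
    row x zs (y ∷ ys) = cong (_ ∙_) (row x zs ys)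

    rows : ∀ xs →
      foldrᵗ (λ s a → foldᵗ (K long) (foldᵗ (K long) (K long) _∙_ nil) (λ y a → (s ∙ y) ∙ a) a)
        nil (encodeList f xs) ≡ encodeList h (cartesianProduct xs ys)
    rows []       = refl
    rows (x ∷ xs) rewrite rows xs =
      trans (foldᵗ≡foldrᵗ (K long) (K long) ≤-refl)
        (trans (cong (foldrᵗ _ _) long≡) (row x (cartesianProduct xs ys) ys))

  writers≡ : ∀ {d t} (Ps : Vec (Thread d) t) → t ≤ len (K short) →
    ⟦ writers ⟧ (encodeList encodeThread (Vec.toList Ps) ∷ []) ≡ encodeList oneHot (allFin t)
  writers≡ Ps t≤ =
    trans (foldᵗ≡foldrᵗ (K short) (encodeList encodeThread (Vec.toList Ps))
            (≤-trans (≤-reflexive (Successors.len-threads K Ps)) t≤))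
          (go Ps t≤)
    where
    shifted : ∀ {n} t (f : Fin t → Fin n) →
      foldrᵗ (λ h a → (nil ∙ h) ∙ a) nil (encodeList oneHot (List.tabulate f)) ≡
      encodeList oneHot (List.tabulate (λ i → suc (f i)))
    shifted zero    f = refl
    shifted (suc t) f = cong ((nil ∙ oneHot (f zero)) ∙_) (shifted t (λ i → f (suc i)))

    go : ∀ {d t} (Ps : Vec (Thread d) t) → t ≤ len (K short) →
      foldrᵗ (λ _ a → ((nil ∙ nil) ∙ nil) ∙
               foldᵗ (K short) (foldᵗ (K short) a _∙_ nil) (λ h a → (nil ∙ h) ∙ a) nil) nil
             (encodeList encodeThread (Vec.toList Ps)) ≡ encodeList oneHot (allFin t)
    go []       _ = refl
    go {t = suc t} (P ∷ Ps) t≤ rewrite go Ps (≤-trans (n≤1+n t) t≤) =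
      cong (((nil ∙ nil) ∙ nil) ∙_)
        (trans (foldᵗ≡foldrᵗ (K short) (encodeList oneHot (allFin t))
                 (≤-trans (≤-reflexive (trans (len-encodeList oneHot (allFin t)) (length-allFin t)))
                          (≤-trans (n≤1+n t) t≤)))
               (shifted t (λ i → i)))

-- Bounds by the size of the input

len≤size : ∀ t → len t ≤ size t
len≤size nil     = z≤n
len≤size (l ∙ r) = s≤s (≤-trans (len≤size r) (m≤n+m (size r) (size l)))

hd≤ : ∀ t → size (hdᵗ t) ≤ size t
hd≤ nil     = ≤-refl
hd≤ (l ∙ r) = ≤-trans (m≤m+n (size l) (size r)) (n≤1+n _)

tl≤ : ∀ t → size (tlᵗ t) ≤ size t
tl≤ nil     = ≤-refl
tl≤ (l ∙ r) = ≤-trans (m≤n+m (size r) (size l)) (n≤1+n _)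

element≤ : ∀ {A : Set} (f : A → Tree) {x xs} → x ∈ xs → size (f x) ≤ size (encodeList f xs)
element≤ f {xs = x ∷ xs} (here refl) = hd≤ (encodeList f (x ∷ xs))
element≤ f {xs = x ∷ xs} (there y∈)  = ≤-trans (element≤ f y∈) (tl≤ (encodeList f (x ∷ xs)))

length≤ : ∀ {A : Set} (f : A → Tree) xs → length xs ≤ size (encodeList f xs)
length≤ f xs = ≤-trans (≤-reflexive (sym (len-encodeList f xs))) (len≤size (encodeList f xs))

set-length≤ : ∀ n → n ≤ size (encodeSet n)
set-length≤ n = subst (_≤ size (encodeSet n)) (length-allFin n) (length≤ (encodeFin {n}) (allFin n))

set-element≤ : ∀ {n} (i : Fin n) → len (encodeFin i) ≤ size (encodeSet n)
set-element≤ i = ≤-trans (len≤size (encodeFin i)) (element≤ encodeFin (∈-allFin i))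

thread-fits : ∀ {N d} (P : Thread d) → size (encodeThread P) ≤ N → ThreadFits N P
thread-fits P P≤ = record
  { state-fits = λ q → ≤-trans (set-element≤ q) states≤
  ; states-fit = ≤-trans (set-length≤ _) states≤
  ; δ-fits     = ≤-trans (length≤ _ (Thread.δ P))
                   (≤-trans (tl≤ (tlᵗ (encodeThread P))) (≤-trans (tl≤ (encodeThread P)) P≤))
  }
  where states≤ = ≤-trans (hd≤ (encodeThread P)) P≤

all-threads-fit : ∀ {N d t} (Ps : Vec (Thread d) t) →
                  size (encodeList encodeThread (Vec.toList Ps)) ≤ N → All (ThreadFits N) Ps
all-threads-fit []       _  = []
all-threads-fit (P ∷ Ps) ≤N =
  thread-fits P (≤-trans (hd≤ Ps′) ≤N) ∷ all-threads-fit Ps (≤-trans (tl≤ Ps′) ≤N)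
  where Ps′ = encodeList encodeThread (Vec.toList (P ∷ Ps))

program-fits : ∀ {N} A → size (encodeProgram A) ≤ N → ProgramFits N A
program-fits A A≤ = record
  { value-fits  = λ a → ≤-trans (set-element≤ a) d≤
  ; domain-fits = ≤-trans (set-length≤ d) d≤
  ; number-fits = ≤-trans (≤-reflexive (sym (Successors.len-threads (λ _ → nil) threads)))
                    (≤-trans (len≤size _) threads≤)
  ; threads-fit = all-threads-fit threads threads≤
  }
  where
  open Program A
  d≤ = ≤-trans (hd≤ (encodeProgram A)) A≤
  threads≤ = ≤-trans (tl≤ (tlᵗ (encodeProgram A))) (≤-trans (tl≤ (encodeProgram A)) A≤)

nodesOf : ∀ A → List (Node A)
nodesOf A = cartesianProduct (allFin t) (cartesianProduct (allFin d) (pcs threads))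
  where open Program A

all-nodesOf : ∀ A x → x ∈ nodesOf A
all-nodesOf A (i , a , pc) =
  ∈-cartesianProduct⁺ (∈-allFin i) (∈-cartesianProduct⁺ (∈-allFin a) (all-pcs pc))

module _ (k : Tree) where

  K : Tree → Clock → Tree
  K = clocks sets cross main k

  crossings : Tree → Tree → Tree
  crossings = crossed sets cross main k

  Bounded : ℕ → Tree → Tree → Set
  Bounded M = Below sets cross main M k

  stateSets : ∀ {d t} → Vec (Thread d) t → Tree → Tree
  stateSets Ps acc = foldlᵗ (λ h a → hdᵗ h ∙ a) acc (encodeList encodeThread (Vec.toList Ps))

  cross-pcs : ∀ {d t} (P : Thread d) (Ps : Vec (Thread d) t) → Thread.states P ≤ len k →
    Semantics.⟦_⟧ (K (encodeList encodePC (pcs Ps))) cross (encodeSet (Thread.states P) ∷ []) ≡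
    encodeList encodePC (pcs (P ∷ Ps))
  cross-pcs P Ps states≤ = trans
    (Crossing.cross≡ (K (encodeList encodePC (pcs Ps))) encodeFin encodePC (allFin states) (pcs Ps)
      (≤-trans (≤-reflexive (length-allFin states)) states≤) refl)
    (sym (encodeList-map encodePC (λ (q , pc) → q ∷ pc) (cartesianProduct (allFin states) (pcs Ps))))
    where open Thread P using (states)

  crossings-stateSets : ∀ {d t} (Ps : Vec (Thread d) t) → All (ThreadFits (len k)) Ps → ∀ acc →
    crossings (stateSets Ps acc) (nil ∙ nil) ≡ crossings acc (encodeList encodePC (pcs Ps))
  crossings-stateSets []       _            acc = refl
  crossings-stateSets (P ∷ Ps) (fit ∷ fits) acc =
    trans (crossings-stateSets Ps fits (encodeSet (Thread.states P) ∙ acc))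
          (cong (crossings acc) (cross-pcs P Ps (ThreadFits.states-fit fit)))

  -- Every thread has an initial state, so crossing with its state set never shortens the list, and
  -- a bound on the last list bounds all earlier ones.
  Bounded-stateSets : ∀ {M d t} (Ps : Vec (Thread d) t) → All (ThreadFits (len k)) Ps → ∀ acc →
    length (pcs Ps) ≤ M → Bounded M acc (encodeList encodePC (pcs Ps)) →
    Bounded M (stateSets Ps acc) (nil ∙ nil)
  Bounded-stateSets []       _            acc _  b = b
  Bounded-stateSets {M} (P ∷ Ps) (fit ∷ fits) acc p≤ b =
    Bounded-stateSets Ps fits (encodeSet (Thread.states P) ∙ acc) tail≤
      (≤-trans (≤-reflexive (len-encodeList encodePC (pcs Ps))) tail≤ ,
       subst (Bounded M acc) (sym (cross-pcs P Ps (ThreadFits.states-fit fit))) b)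
    where
    tail≤ : length (pcs Ps) ≤ M
    tail≤ = ≤-trans (≤-trans (m≤n*m (length (pcs Ps)) (Thread.states P) {{>-nonZero (states≥1 P)}})
                             (≤-reflexive (sym (length-pcs P Ps)))) p≤

  len-stateSets : ∀ {d t} (Ps : Vec (Thread d) t) acc → len (stateSets Ps acc) ≡ t + len acc
  len-stateSets []       acc = refl
  len-stateSets {t = suc t} (P ∷ Ps) acc =
    trans (len-stateSets Ps (encodeSet (Thread.states P) ∙ acc)) (+-suc t (len acc))

-- Opaque, as its components would otherwise be computed in unary.
opaque
  totalTime-polynomial : ∃[ m ] ∃[ a ] (∀ {L} → (∀ κ → 1 ≤ L κ) →
    evalCost L (totalTime sets cross main) ≤ m * (L short ^ a * L long ^ 2))
  totalTime-polynomial = polynomial (totalTime sets cross main) refl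

leading exponent : ℕ
leading  = proj₁ totalTime-polynomial
exponent = proj₁ (proj₂ totalTime-polynomial)

-- Assembly for a given instance

module _ (I : Instance) where
  open Instance I renaming (program to A)
  open Program A

  x k : Tree
  x = encodeInstance I
  k = ticks x nil

  len-k : len k ≡ size x
  len-k = len-shortTree sets cross main x

  size-program≤ : size (encodeProgram A) ≤ len k
  size-program≤ = ≤-trans (hd≤ x) (≤-reflexive (sym len-k))

  fits : ProgramFits (len k) A
  fits = program-fits A size-program≤

  open ProgramFits fits

  nodes : List (Node A)
  nodes = nodesOf A

  M : ℕ
  M = length nodes

  values writersᵗ : Tree
  values   = encodeSet d
  writersᵗ = encodeList oneHot (allFin t)

  sets≡ : setsTree sets cross main x ≡ stateSets k threads (values ∙ writersᵗ ∙ nil)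
  sets≡ = trans
    (foldᵗ≡foldlᵗ k (encodeList encodeThread (Vec.toList threads))
      (≤-trans (≤-reflexive (Successors.len-threads (λ _ → nil) threads)) number-fits))
    (cong (λ w → stateSets k threads (values ∙ w ∙ nil))
      (Crossing.writers≡ (K k (nil ∙ nil)) threads number-fits))

  memories : List (Fin d × PC threads)
  memories = cartesianProduct (allFin d) (pcs threads)

  encodeMemory : Fin d × PC threads → Tree
  encodeMemory (a , pc) = encodeFin a ∙ encodePC pc

  cross-values : Semantics.⟦_⟧ (K k (encodeList encodePC (pcs threads))) cross (values ∷ []) ≡
                 encodeList encodeMemory memories
  cross-values = Crossing.cross≡ (K k (encodeList encodePC (pcs threads))) encodeFin encodePC
    (allFin d) (pcs threads) (≤-trans (≤-reflexive (length-allFin d)) domain-fits) refl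

  encodeNode′ : Node A → Tree
  encodeNode′ (i , m) = oneHot i ∙ encodeMemory m

  cross-writers : Semantics.⟦_⟧ (K k (encodeList encodeMemory memories)) cross (writersᵗ ∷ []) ≡
                  encodeList encodeNode′ nodes
  cross-writers = Crossing.cross≡ (K k (encodeList encodeMemory memories)) oneHot encodeMemory
    (allFin t) memories (≤-trans (≤-reflexive (length-allFin t)) number-fits) refl

  long≡ : longTree sets cross main x ≡ encodeList encodeNode′ nodes
  long≡ = trans (cong (λ S → crossings k S (nil ∙ nil)) sets≡)
    (trans (crossings-stateSets k threads threads-fit (values ∙ writersᵗ ∙ nil))
      (trans (cong (crossings k (writersᵗ ∙ nil)) cross-values) cross-writers))

  length-memories : length memories ≡ d * length (pcs threads)
  length-memories = trans (length-cartesianProduct (allFin d) (pcs threads))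
    (cong (_* length (pcs threads)) (length-allFin d))

  length-nodes : M ≡ t * length memories
  length-nodes = trans (length-cartesianProduct (allFin t) memories)
    (cong (_* length memories) (length-allFin t))

  memories≤ : length memories ≤ M
  memories≤ = ≤-trans (m≤n*m (length memories) t) (≤-reflexive (sym length-nodes))

  pcs≤M : length (pcs threads) ≤ M
  pcs≤M = ≤-trans
    (≤-trans (m≤n*m (length (pcs threads)) d {{>-nonZero (≤-trans (s≤s z≤n) (Fin.toℕ<n a⁰))}})
             (≤-reflexive (sym length-memories))) memories≤

  bounded : Below sets cross main M k (setsTree sets cross main x) (nil ∙ nil)
  bounded = subst (λ S → Bounded k M S (nil ∙ nil)) (sym sets≡)
    (Bounded-stateSets k threads threads-fit (values ∙ writersᵗ ∙ nil) pcs≤M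
      (≤-trans (≤-reflexive (len-encodeList encodePC (pcs threads))) pcs≤M ,
       subst (Bounded k M (writersᵗ ∙ nil)) (sym cross-values)
         (≤-trans (≤-reflexive (len-encodeList encodeMemory memories)) memories≤ ,
          ≤-reflexive (trans (cong len cross-writers) (len-encodeList encodeNode′ nodes)))))

  sets-length : len (setsTree sets cross main x) ≤ len k
  sets-length = begin
    len (setsTree sets cross main x)  ≡⟨ trans (cong len sets≡) (len-stateSets k threads _) ⟩
    -- The two sets besides those of the threads are the values and the writers.
    t + 2                             ≡⟨ +-comm t 2 ⟩
    2 + t                             ≡⟨ cong (2 +_) (Successors.len-threads (λ _ → nil) threads) ⟨
    2 + len threadsᵗ                  ≤⟨ s≤s (s≤s (len≤size threadsᵗ)) ⟩
    2 + size threadsᵗ                 ≤⟨ s≤s (s≤s (m≤n+m (size threadsᵗ) (size (encodeFin a⁰)))) ⟩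
    2 + (size (encodeFin a⁰) + size threadsᵗ)  ≤⟨ s≤s (m≤n+m _ (size values)) ⟩
    size (encodeProgram A)            ≤⟨ size-program≤ ⟩
    len k ∎
    where
    open ≤-Reasoning
    threadsᵗ = encodeList encodeThread (Vec.toList threads)

  reachable-decides : Decides (Reachable I)
    (Semantics.⟦_⟧ (clocks sets cross main k (longTree sets cross main x)) main (x ∷ []))
  reachable-decides = Decision.main-decides (K k (longTree sets cross main x)) I fits
    (≤-trans (length≤ (encodeConfig {A}) Cᶠ)
      (≤-trans (hd≤ (tlᵗ x)) (≤-trans (tl≤ x) (≤-reflexive (sym len-k)))))
    (≤-trans (len≤size (encodeℕ s))
      (≤-trans (tl≤ (tlᵗ x)) (≤-trans (tl≤ x) (≤-reflexive (sym len-k)))))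
    nodes (all-nodesOf A) long≡

  M≥1 : 1 ≤ M
  M≥1 = ≤-trans (pcs≥1 threads) pcs≤M

  P n : ℕ
  P = maxStates A
  n = size x

  -- The input writes out the domain and the threads element by element, so `d` and `t` are at most
  -- `n` although numbers are in binary; only the tuples of states can be exponentially many.
  M≤ : M ≤ n * (n * P ^ t)
  M≤ = ≤-trans (≤-reflexive (trans length-nodes (cong (t *_) length-memories)))
    (*-mono-≤ (n≥ number-fits) (*-mono-≤ (n≥ domain-fits) (pcs≤ threads)))
    where
    n≥ : ∀ {m} → m ≤ len k → m ≤ n
    n≥ m≤ = ≤-trans m≤ (≤-reflexive len-k)

  L : Clock → ℕ
  L = lengths sets cross main k M

  size≥1 : ∀ t → 1 ≤ size t
  size≥1 nil     = s≤s z≤n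
  size≥1 (_ ∙ _) = s≤s z≤n

  L≥1 : ∀ κ → 1 ≤ L κ
  L≥1 short = ≤-trans (size≥1 x) (≤-reflexive (sym len-k))
  L≥1 long  = M≥1

  -- The 4 comes from `M ^ 2`, in which each `M` contributes two factors `n`.
  time≤ : evalCost L (totalTime sets cross main) ≤ leading * n ^ (exponent + 4) * P ^ (2 * t)
  time≤ = begin
    evalCost L (totalTime sets cross main)
      ≤⟨ proj₂ (proj₂ totalTime-polynomial) L≥1 ⟩
    leading * (len k ^ exponent * M ^ 2)
      ≤⟨ *-monoʳ-≤ leading (*-mono-≤ (≤-reflexive (cong (_^ exponent) len-k)) (^-monoˡ-≤ 2 M≤)) ⟩
    leading * (n ^ exponent * (n * (n * P ^ t)) ^ 2)
      ≡⟨ rearrange leading (n ^ exponent) n (P ^ t) ⟩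
    leading * (n ^ exponent * n ^ 4) * (P ^ t) ^ 2
      ≡⟨ cong₂ (λ u v → leading * u * v) (sym (^-distribˡ-+-* n exponent 4))
           (trans (^-*-assoc P t 2) (cong (P ^_) (*-comm t 2))) ⟩
    leading * n ^ (exponent + 4) * P ^ (2 * t) ∎
    where
    open ≤-Reasoning

    rearrange : ∀ c m n p → c * (m * (n * (n * p) * (n * (n * p) * 1))) ≡
                            c * (m * (n * (n * (n * (n * 1))))) * (p * (p * 1))
    rearrange = solve-∀

  run≤ : ∃[ τ ] (threePhases sets cross main , x ∷ nil ∷ nil ∷ []
    ⇓≤[ evalCost L (totalTime sets cross main) ]
    Semantics.⟦_⟧ (K k (longTree sets cross main x)) main (x ∷ []) ∷ τ)
  run≤ = threePhases≤ sets cross main x M≥1 bounded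
    (≤-reflexive (trans (cong len long≡) (len-encodeList encodeNode′ nodes))) sets-length

proposition20 :
  SolvableInTimeO* BSR
    (λ I → let A = Instance.program I in
           maxStates A ^ (2 * Program.t A))
proposition20 =
  record { locals = 2 ; body = threePhases sets cross main } ,
  (λ I → leading * size (encodeInstance I) ^ (exponent + 4) *
         maxStates (Instance.program I) ^ (2 * Program.t (Instance.program I))) ,
  (leading , exponent + 4 , λ I → ≤-refl) ,
  λ I → let τ , m , r , m≤ = run≤ I in
        m , _ , (τ , r) , ≤-trans m≤ (time≤ I) , Decides⇒⇔ (reachable-decides I)
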